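{- Let $\mathfrak{A}$ be a countably infinite, recursively saturated structure for a finite first-order language. Then the group $\mathrm{Aut}((\mathbb{Q},<))$ embeds (as a group) into $\mathrm{Aut}(\mathfrak{A})$.
   Context: $(\mathbb{Q},<)$ is the rationals with their usual ordering; $\mathrm{Aut}(\cdot)$ denotes the automorphism group of a structure. -}

module Defs where

open import Data.Nat using (ℕ; zero; suc; _+_; _<_; _≡ᵇ_)
open import Data.Fin using (Fin; toℕ)
open import Data.Vec using (Vec; []; _∷_; map)
open import Data.List using (List)
open import Data.List.Relation.Unary.All using (All)
open import Data.Product using (Σ; _×_; _,_; proj₁; proj₂)
open import Data.Sum using (_⊎_)
open import Data.Empty using (⊥)
open import Data.Unit using (⊤)
open import Data.Bool using (if_then_else_)
open import Relation.Nullary using (¬_)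
open import Relation.Binary.PropositionalEquality using (_≡_; _≢_)
open import Function.Bundles using (_↔_; Inverse)
open import Function.Construct.Composition using (_↔-∘_)
import Data.Rational as Q

record Language : Set where
  field
    nFun    : ℕ                -- number of function symbols (constants = arity 0)
    nRel    : ℕ
    funAr   : Fin nFun → ℕ
    relAr   : Fin nRel → ℕ

module Syntax (L : Language) where
  open Language L

  data Term : Set where
    var : ℕ → Term
    app : (f : Fin nFun) → Vec Term (funAr f) → Term

  data Formula : Set where
    ⊥'   : Formula
    _≐_  : Term → Term → Formula
    rel  : (r : Fin nRel) → Vec Term (relAr r) → Formula
    ¬'_  : Formula → Formula
    _∧'_ : Formula → Formula → Formula
    _∨'_ : Formula → Formula → Formula
    _⇒'_ : Formula → Formula → Formula
    ∀'   : ℕ → Formula → Formula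
    ∃'   : ℕ → Formula → Formula

  mutual
    OccT : ℕ → Term → Set
    OccT j (var i)    = j ≡ i
    OccT j (app f ts) = OccTs j ts

    OccTs : ∀ {n} → ℕ → Vec Term n → Set
    OccTs j []       = ⊥
    OccTs j (t ∷ ts) = OccT j t ⊎ OccTs j ts

  Free : ℕ → Formula → Set
  Free j ⊥'         = ⊥
  Free j (s ≐ t)    = OccT j s ⊎ OccT j t
  Free j (rel r ts) = OccTs j ts
  Free j (¬' φ)     = Free j φ
  Free j (φ ∧' ψ)   = Free j φ ⊎ Free j ψ
  Free j (φ ∨' ψ)   = Free j φ ⊎ Free j ψ
  Free j (φ ⇒' ψ)   = Free j φ ⊎ Free j ψ
  Free j (∀' i φ)   = j ≢ i × Free j φ
  Free j (∃' i φ)   = j ≢ i × Free j φ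

  FreeVarsBelow : ℕ → Formula → Set
  FreeVarsBelow k φ = ∀ j → Free j φ → j < k

  -- Gödel numbering (Cantor pairing)

  tri : ℕ → ℕ
  tri zero    = zero
  tri (suc n) = suc n + tri n

  pair : ℕ → ℕ → ℕ
  pair a b = tri (a + b) + b

  mutual
    codeT : Term → ℕ
    codeT (var i)    = pair 0 i
    codeT (app f ts) = pair 1 (pair (toℕ f) (codeTs ts))

    codeTs : ∀ {n} → Vec Term n → ℕ
    codeTs []       = 0
    codeTs (t ∷ ts) = suc (pair (codeT t) (codeTs ts))

  code : Formula → ℕ
  code ⊥'         = pair 0 0
  code (s ≐ t)    = pair 1 (pair (codeT s) (codeT t))
  code (rel r ts) = pair 2 (pair (toℕ r) (codeTs ts))
  code (¬' φ)     = pair 3 (code φ)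
  code (φ ∧' ψ)   = pair 4 (pair (code φ) (code ψ))
  code (φ ∨' ψ)   = pair 5 (pair (code φ) (code ψ))
  code (φ ⇒' ψ)   = pair 6 (pair (code φ) (code ψ))
  code (∀' i φ)   = pair 7 (pair i (code φ))
  code (∃' i φ)   = pair 8 (pair i (code φ))

record Structure (L : Language) : Set₁ where
  open Language L
  field
    Carrier : Set
    funI    : (f : Fin nFun) → Vec Carrier (funAr f) → Carrier
    relI    : (r : Fin nRel) → Vec Carrier (relAr r) → Set

module Semantics {L : Language} (𝔄 : Structure L) where
  open Language L
  open Syntax L
  open Structure 𝔄

  Assignment : Set
  Assignment = ℕ → Carrier

  _[_↦_] : Assignment → ℕ → Carrier → Assignment
  (ρ [ i ↦ a ]) j = if j ≡ᵇ i then a else ρ j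

  mutual
    evalT : Assignment → Term → Carrier
    evalT ρ (var i)    = ρ i
    evalT ρ (app f ts) = funI f (evalTs ρ ts)

    evalTs : ∀ {n} → Assignment → Vec Term n → Vec Carrier n
    evalTs ρ []       = []
    evalTs ρ (t ∷ ts) = evalT ρ t ∷ evalTs ρ ts

  Sat : Assignment → Formula → Set
  Sat ρ ⊥'         = ⊥
  Sat ρ (s ≐ t)    = evalT ρ s ≡ evalT ρ t
  Sat ρ (rel r ts) = relI r (evalTs ρ ts)
  Sat ρ (¬' φ)     = ¬ Sat ρ φ
  Sat ρ (φ ∧' ψ)   = Sat ρ φ × Sat ρ ψ
  Sat ρ (φ ∨' ψ)   = Sat ρ φ ⊎ Sat ρ ψ
  Sat ρ (φ ⇒' ψ)   = Sat ρ φ → Sat ρ ψ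
  Sat ρ (∀' i φ)   = (a : Carrier) → Sat (ρ [ i ↦ a ]) φ
  Sat ρ (∃' i φ)   = Σ Carrier λ a → Sat (ρ [ i ↦ a ]) φ

  -- assignment x₀ ↦ a , x₍ᵢ₊₁₎ ↦ bᵢ (i < n); remaining variables ↦ a (irrelevant)
  envV : ∀ {n} → Carrier → Vec Carrier n → ℕ → Carrier
  envV a []       i       = a
  envV a (b ∷ bs) zero    = b
  envV a (b ∷ bs) (suc i) = envV a bs i

  env : ∀ {n} → Carrier → Vec Carrier n → Assignment
  env a bs zero    = a
  env a bs (suc i) = envV a bs i

data PR : ℕ → Set where
  Zc : ∀ {k} → PR k
  Sc : PR 1
  Pc : ∀ {k} → Fin k → PR k
  Cc : ∀ {k m} → PR m → Vec (PR k) m → PR k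
  Rc : ∀ {k} → PR k → PR (suc (suc k)) → PR (suc k)
  Mc : ∀ {k} → PR (suc k) → PR k

lookupV : ∀ {A : Set} {k} → Vec A k → Fin k → A
lookupV (x ∷ xs) Fin.zero    = x
lookupV (x ∷ xs) (Fin.suc i) = lookupV xs i

mutual
  data Eval : ∀ {k} → PR k → Vec ℕ k → ℕ → Set where
    evZ : ∀ {k} {xs : Vec ℕ k} → Eval Zc xs 0
    evS : ∀ {x} → Eval Sc (x ∷ []) (suc x)
    evP : ∀ {k} {xs : Vec ℕ k} (i : Fin k) → Eval (Pc i) xs (lookupV xs i)
    evC : ∀ {k m} {g : PR m} {hs : Vec (PR k) m} {xs : Vec ℕ k} {ys : Vec ℕ m} {v} →
          EvalAll hs xs ys → Eval g ys v → Eval (Cc g hs) xs v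
    evR0 : ∀ {k} {g : PR k} {h : PR (suc (suc k))} {xs : Vec ℕ k} {v} →
           Eval g xs v → Eval (Rc g h) (0 ∷ xs) v
    evRs : ∀ {k} {g : PR k} {h : PR (suc (suc k))} {xs : Vec ℕ k} {n r v} →
           Eval (Rc g h) (n ∷ xs) r → Eval h (n ∷ r ∷ xs) v →
           Eval (Rc g h) (suc n ∷ xs) v
    evM : ∀ {k} {f : PR (suc k)} {xs : Vec ℕ k} {n} →
          Eval f (n ∷ xs) 0 →
          (∀ m → m < n → Σ ℕ λ v → Eval f (m ∷ xs) (suc v)) →
          Eval (Mc f) xs n

  data EvalAll {k} : ∀ {m} → Vec (PR k) m → Vec ℕ k → Vec ℕ m → Set where
    []  : ∀ {xs} → EvalAll [] xs []
    _∷_ : ∀ {m} {h} {hs : Vec (PR k) m} {xs y ys} →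
          Eval h xs y → EvalAll hs xs ys → EvalAll (h ∷ hs) xs (y ∷ ys)

RecursiveSet : (ℕ → Set) → Set
RecursiveSet P = Σ (PR 1) λ e → ∀ x →
  (P x × Eval e (x ∷ []) 0) ⊎ (¬ P x × Eval e (x ∷ []) 1)

module _ {L : Language} (𝔄 : Structure L) where
  open Syntax L
  open Semantics 𝔄
  open Structure 𝔄

  -- p is a recursive set of formulas φ(x, y₁ , … , yₙ)  (x = variable 0, yᵢ = variable i)
  RecursiveType : ℕ → (Formula → Set) → Set
  RecursiveType n p =
    (∀ φ → p φ → FreeVarsBelow (suc n) φ) ×
    RecursiveSet (λ c → Σ Formula λ φ → p φ × code φ ≡ c)

  FinitelySatisfiable : ∀ {n} → (Formula → Set) → Vec Carrier n → Set
  FinitelySatisfiable p bs = (Φ : List Formula) → All p Φ →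
    Σ Carrier λ a → All (Sat (env a bs)) Φ

  Realized : ∀ {n} → (Formula → Set) → Vec Carrier n → Set
  Realized p bs = Σ Carrier λ a → ∀ φ → p φ → Sat (env a bs) φ

  RecursivelySaturated : Set₁
  RecursivelySaturated = ∀ n (bs : Vec Carrier n) (p : Formula → Set) →
    RecursiveType n p → FinitelySatisfiable p bs → Realized p bs

  CountablyInfinite : Set
  CountablyInfinite = Carrier ↔ ℕ

  record Aut : Set where
    field
      bij    : Carrier ↔ Carrier
    open Inverse bij using (to)
    field
      presF  : ∀ f (xs : Vec Carrier (Language.funAr L f)) →
               to (funI f xs) ≡ funI f (map to xs)
      presR  : ∀ r (xs : Vec Carrier (Language.relAr L r)) →
               (relI r xs → relI r (map to xs)) × (relI r (map to xs) → relI r xs)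

  app𝔄 : Aut → Carrier → Carrier
  app𝔄 σ = Inverse.to (Aut.bij σ)

  _≈𝔄_ : Aut → Aut → Set
  σ ≈𝔄 τ = ∀ x → app𝔄 σ x ≡ app𝔄 τ x

record AutQ : Set where
  field
    bij : Q.ℚ ↔ Q.ℚ
  open Inverse bij using (to)
  field
    ord : ∀ x y → (x Q.< y → to x Q.< to y) × (to x Q.< to y → x Q.< y)

appQ : AutQ → Q.ℚ → Q.ℚ
appQ σ = Inverse.to (AutQ.bij σ)

_≈Q_ : AutQ → AutQ → Set
σ ≈Q τ = ∀ x → appQ σ x ≡ appQ τ x

_∘Q_ : AutQ → AutQ → AutQ
σ ∘Q τ = record
  { bij = AutQ.bij σ ↔-∘ AutQ.bij τ
  ; ord = λ x y →
      (λ x<y → proj₁ (AutQ.ord σ (appQ τ x) (appQ τ y)) (proj₁ (AutQ.ord τ x y) x<y)) ,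
      (λ s → proj₂ (AutQ.ord τ x y) (proj₂ (AutQ.ord σ (appQ τ x) (appQ τ y)) s))
  }

record GroupEmbedding {L : Language} (𝔄 : Structure L) : Set where
  field
    Φ      : AutQ → Aut 𝔄
    cong   : ∀ {σ τ} → σ ≈Q τ → _≈𝔄_ 𝔄 (Φ σ) (Φ τ)
    hom    : ∀ σ τ x → app𝔄 𝔄 (Φ (σ ∘Q τ)) x ≡ app𝔄 𝔄 (Φ σ) (app𝔄 𝔄 (Φ τ) x)
    inj    : ∀ {σ τ} → _≈𝔄_ 𝔄 (Φ σ) (Φ τ) → σ ≈Q τ

{-# OPTIONS --safe #-}
module Submission where

-- The structure is presented as the set of values of formal terms t_j (q₁ , … , qₖ) at points of ℚ, in
-- such a way that the truth of an atomic formula depends only on the order type of the points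
-- involved; then t_j (q₁ , … , qₖ) ↦ t_j (σ q₁ , … , σ qₖ) is an automorphism for every σ ∈ Aut (ℚ , <).
-- The presentation is built by finite approximations: finitely many values such that, for all n
-- and N, some array of values over N points has all its increasing samples indistinguishable
-- from the given ones in the n-round Ehrenfeucht–Fraïssé game.  By Ramsey's theorem the demands on
-- a value at one further index are finitely satisfiable; they are a computable sequence of formulas,
-- built around the formula that defines the n-round game, so recursive saturation provides the
-- value.  Surjectivity is achieved by adjoining an arbitrary element as the value of a fresh term at
-- all the points in use, which costs only one round of the game.  The values t_0 (q) are kept
-- distinct, so that the action is faithful.

open import Defs
open import Level using (0ℓ)
open import Axiom.ExcludedMiddle using (ExcludedMiddle)

open import Data.Bool using (true; false)
open import Data.Empty using (⊥-elim)
open import Data.Fin using (Fin; zero; suc; toℕ; fromℕ; fromℕ<; inject₁)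
open import Data.Fin.Properties using (toℕ<n; toℕ-fromℕ<; fromℕ<-toℕ; fromℕ<-cong)
open import Data.Integer using (ℤ; +_; -[1+_])
open import Data.List as List using (List; []; _∷_; _++_; length; upTo)
import Data.List.Properties as List
open import Data.List.Membership.Propositional using (_∈_)
open import Data.List.Membership.Propositional.Properties
  using (∈-map⁺; ∈-++⁺ˡ; ∈-++⁺ʳ; ∈-allFin; ∈-cartesianProductWith⁺; ∈-concatMap⁺)
open import Data.List.Relation.Binary.Sublist.Propositional
  using (_⊆_; []; _∷_; _∷ʳ_; ⊆-refl; ⊆-trans; minimum)
open import Data.List.Relation.Binary.Sublist.Propositional.Properties using (All-resp-⊆)
open import Data.List.Relation.Unary.All as All using (All; []; _∷_)
import Data.List.Relation.Unary.All.Properties as All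
open import Data.List.Relation.Unary.AllPairs using (AllPairs; []; _∷_)
import Data.List.Relation.Unary.AllPairs.Properties as AllPairs
open import Data.List.Relation.Unary.Any as Any using (here; there)
open import Data.Maybe using (Maybe; just; nothing; maybe′)
open import Data.Nat
open import Data.Nat.Properties
open import Data.Product using (Σ; _×_; _,_; proj₁; proj₂)
import Data.Rational as Q
import Data.Rational.Properties as Q
open import Data.Sum using (_⊎_; inj₁; inj₂; [_,_]′)
open import Data.Unit using (⊤; tt)
open import Data.Vec as Vec using (Vec; []; _∷_)
import Data.Vec.Properties as Vec
open import Function using (_∘_; id)
open import Function.Bundles using (_⇔_; mk⇔; mk↔ₛ′; Inverse; module Equivalence)
open import Function.Construct.Composition using (_⇔-∘_)
open import Function.Construct.Identity using (⇔-id)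
open import Function.Construct.Symmetry using (⇔-sym)
open import Relation.Binary.Definitions using (tri<; tri≈; tri>)
open import Relation.Binary.PropositionalEquality
  using (_≡_; _≢_; _≗_; refl; sym; trans; cong; cong₂; subst; subst₂)
open import Relation.Nullary using (¬_; Dec; yes; no)

open Equivalence using (to; from)

-- Ramsey's theorem

-- The pattern is that of an Ehrenfeucht-Mostowski model, found inside the given structure. The
-- language has no Skolem functions, and an expansion by them need not be recursively saturated; so
-- the terms t_j are mere names, and their values are chosen one at a time. Two obstacles shape the
-- proof. The type of the values already chosen need not be recursive, so a demand cannot list the
-- formulas true of them. Instead the values enter as parameters and are compared, in the game, with
-- samples of an existentially quantified array; such a formula depends only on the language, the
-- number of values and the shape of the indices. And a single formula cannot speak of an array over
-- ℚ, whence arrays over N points for every N. The finiteness of the language is used twice: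
-- finitely many positions carry finitely many atoms, so the n-round game is defined by one formula,
-- computable from n, and its equivalence has finite index, as Ramsey's theorem requires.

module Ramsey (em : ExcludedMiddle 0ℓ) {X : Set} where

  Homogeneous : ℕ → (List X → Set) → List X → Set
  Homogeneous m C S = ∀ s t → s ⊆ S → t ⊆ S → length s ≡ m → length t ≡ m → C s → C t

  homogeneous-⊆ : ∀ {m C S T} → S ⊆ T → Homogeneous m C T → Homogeneous m C S
  homogeneous-⊆ S⊆T h s t s⊆ t⊆ = h s t (⊆-trans s⊆ S⊆T) (⊆-trans t⊆ S⊆T)

  -- The colour of a tuple of length `suc m` depends on its first entry alone; this is the usual
  -- step between the exponents `m` and `suc m`.
  data EndHomogeneous (m : ℕ) (C : List X → Set) : List X → Set where
    []  : EndHomogeneous m C []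
    _∷_ : ∀ {x S} → Homogeneous m (C ∘ (x ∷_)) S → EndHomogeneous m C S →
          EndHomogeneous m C (x ∷ S)

  Uniform : ℕ → (List X → Set) → List X → Set
  Uniform m C S = ∀ s → s ⊆ S → length s ≡ suc m → C s

  uniform-[] : ∀ {m C} → Uniform m C []
  uniform-[] .[] [] ()

  pigeonhole : ∀ {m C} A B S → EndHomogeneous m C S → A + B ≤ length S →
    Σ (List X) λ S′ → S′ ⊆ S × ((A ≤ length S′ × Uniform m C S′) ⊎
                                (B ≤ length S′ × Uniform m (¬_ ∘ C) S′))
  pigeonhole zero    B       S _ _ = [] , minimum S , inj₁ (z≤n , uniform-[])
  pigeonhole (suc A) zero    S _ _ = [] , minimum S , inj₂ (z≤n , uniform-[])
  pigeonhole {m} {C} (suc A) (suc B) (x ∷ S) (h ∷ e) (s≤s le)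
    with em {Σ (List X) λ s → s ⊆ S × length s ≡ m × C (x ∷ s)}
  ... | yes (s , s⊆S , ls , Cs) with pigeonhole A (suc B) S e le
  ...   | S′ , S′⊆S , inj₁ (A≤ , u) = x ∷ S′ , refl ∷ S′⊆S , inj₁ (s≤s A≤ , u′)
    where
    u′ : Uniform m C (x ∷ S′)
    u′ t (_ ∷ʳ t⊆) lt = u t t⊆ lt
    u′ (_ ∷ t) (refl ∷ t⊆) lt = h s t s⊆S (⊆-trans t⊆ S′⊆S) ls (suc-injective lt) Cs
  ...   | S′ , S′⊆S , inj₂ r = S′ , x ∷ʳ S′⊆S , inj₂ r
  pigeonhole {m} {C} (suc A) (suc B) (x ∷ S) (h ∷ e) (s≤s le) | no ¬s
    with pigeonhole (suc A) B S e (subst (_≤ length S) (+-suc A B) le)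
  ...   | S′ , S′⊆S , inj₁ r = S′ , x ∷ʳ S′⊆S , inj₁ r
  ...   | S′ , S′⊆S , inj₂ (B≤ , u) = x ∷ S′ , refl ∷ S′⊆S , inj₂ (s≤s B≤ , u′)
    where
    u′ : Uniform m (¬_ ∘ C) (x ∷ S′)
    u′ t (_ ∷ʳ t⊆) lt = u t t⊆ lt
    u′ (_ ∷ t) (refl ∷ t⊆) lt Ct = ¬s (t , ⊆-trans t⊆ S′⊆S , suc-injective lt , Ct)

  mutual
    ramsey : ∀ m N → Σ ℕ λ M → ∀ C S → M ≤ length S →
      Σ (List X) λ S′ → S′ ⊆ S × N ≤ length S′ × Homogeneous m C S′
    ramsey zero N = N , λ C S le → S , ⊆-refl , le , λ { [] [] _ _ _ _ c → c }
    ramsey (suc m) N = proj₁ (endRamsey m (N + N)) , go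
      where
      go : ∀ C S → proj₁ (endRamsey m (N + N)) ≤ length S →
        Σ (List X) λ S′ → S′ ⊆ S × N ≤ length S′ × Homogeneous (suc m) C S′
      go C S le with proj₂ (endRamsey m (N + N)) C S le
      ... | T , T⊆S , NN≤T , e with pigeonhole N N T e NN≤T
      ...   | S′ , S′⊆T , inj₁ (N≤ , u) =
        S′ , ⊆-trans S′⊆T T⊆S , N≤ , λ s t _ t⊆ _ lt _ → u t t⊆ lt
      ...   | S′ , S′⊆T , inj₂ (N≤ , u) =
        S′ , ⊆-trans S′⊆T T⊆S , N≤ , λ s t s⊆ _ ls _ Cs → ⊥-elim (u s s⊆ ls Cs)

    -- Each head prunes the rest of the list to a part homogeneous for the colouring of exponent `m`
    -- that it induces; the bounds are nested so that enough is left for the later heads.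
    endRamsey : ∀ m L → Σ ℕ λ M → ∀ C S → M ≤ length S →
      Σ (List X) λ S′ → S′ ⊆ S × L ≤ length S′ × EndHomogeneous m C S′
    endRamsey m zero = 0 , λ C S _ → [] , minimum S , z≤n , []
    endRamsey m (suc L) = suc (proj₁ (ramsey m (proj₁ (endRamsey m L)))) , go
      where
      go : ∀ C S → suc (proj₁ (ramsey m (proj₁ (endRamsey m L)))) ≤ length S →
        Σ (List X) λ S′ → S′ ⊆ S × suc L ≤ length S′ × EndHomogeneous m C S′
      go C (x ∷ S) (s≤s le) with proj₂ (ramsey m (proj₁ (endRamsey m L))) (C ∘ (x ∷_)) S le
      ... | T , T⊆S , le′ , h with proj₂ (endRamsey m L) C T le′
      ...   | S′ , S′⊆T , L≤ , e =
        x ∷ S′ , refl ∷ ⊆-trans S′⊆T T⊆S , s≤s L≤ , homogeneous-⊆ S′⊆T h ∷ e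

  -- The bound depends only on the number of colourings: the array that defines them is chosen after
  -- the bound.
  ramsey-family : ∀ m k N → Σ ℕ λ M → ∀ (Cs : List (List X → Set)) → length Cs ≡ k →
    ∀ S → M ≤ length S →
    Σ (List X) λ S′ → S′ ⊆ S × N ≤ length S′ × All (λ C → Homogeneous m C S′) Cs
  ramsey-family m zero N = N , λ { [] _ S le → S , ⊆-refl , le , [] }
  ramsey-family m (suc k) N = proj₁ (ramsey m (proj₁ (ramsey-family m k N))) , go
    where
    go : ∀ Cs → length Cs ≡ suc k → ∀ S →
      proj₁ (ramsey m (proj₁ (ramsey-family m k N))) ≤ length S →
      Σ (List X) λ S′ → S′ ⊆ S × N ≤ length S′ × All (λ C → Homogeneous m C S′) Cs
    go (C ∷ Cs) lk S le with proj₂ (ramsey m (proj₁ (ramsey-family m k N))) C S le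
    ... | T , T⊆S , le′ , h with proj₂ (ramsey-family m k N) Cs (suc-injective lk) T le′
    ...   | S′ , S′⊆T , N≤ , hs = S′ , ⊆-trans S′⊆T T⊆S , N≤ , homogeneous-⊆ S′⊆T h ∷ hs

-- The entry at position x, where positions are counted from o; 0 outside the list.
at : ℕ → List ℕ → ℕ → ℕ
at o []      x = 0
at o (y ∷ S) x with x ≟ o
... | yes _ = y
... | no  _ = at (suc o) S x

at-suc : ∀ o y S {xs} → All (o <_) xs → List.map (at (suc o) S) xs ≡ List.map (at o (y ∷ S)) xs
at-suc o y S [] = refl
at-suc o y S (_∷_ {x = x} o<x o<xs) with x ≟ o
... | yes refl = ⊥-elim (<-irrefl refl o<x)
... | no  _    = cong (_ ∷_) (at-suc o y S o<xs)

-- Ramsey's theorem sees tuples as sublists; this converts an increasing tuple of positions into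
-- one.
map-at-⊆ : ∀ o S xs → AllPairs _<_ xs → All (o ≤_) xs → All (_< o + length S) xs →
  List.map (at o S) xs ⊆ S
map-at-⊆ o S [] _ _ _ = minimum S
map-at-⊆ o [] (x ∷ xs) _ (o≤x ∷ _) (x< ∷ _) =
  ⊥-elim (<⇒≱ x< (subst (_≤ x) (sym (+-identityʳ o)) o≤x))
map-at-⊆ o (y ∷ S) (x ∷ xs) (x<xs ∷ ap) (o≤x ∷ o≤xs) (x< ∷ xs<) rewrite +-suc o (length S)
  with x ≟ o
... | yes refl = refl ∷ subst (_⊆ S) (at-suc o y S x<xs) (map-at-⊆ (suc o) S xs ap x<xs xs<)
... | no x≢o = y ∷ʳ subst (_⊆ S) (cong (at (suc o) S x ∷_) (at-suc o y S (All.map (<-trans o<x) x<xs)))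
        (map-at-⊆ (suc o) S (x ∷ xs) (x<xs ∷ ap) (o<x ∷ All.map (<-trans o<x) x<xs) (x< ∷ xs<))
  where
  o<x : o < x
  o<x = ≤∧≢⇒< o≤x (x≢o ∘ sym)

-- Unnested atoms and the Ehrenfeucht–Fraïssé game

module _ (L : Language) where
  open Language L

  -- Arguments and values are positions and not terms, so that finitely many positions carry only
  -- finitely many atoms.
  data Atom (I : Set) : Set where
    eqA  : I → I → Atom I
    funA : (f : Fin nFun) → Vec I (funAr f) → I → Atom I
    relA : (r : Fin nRel) → Vec I (relAr r) → Atom I

module _ {L : Language} where
  open Language L

  mapA : ∀ {I J} → (I → J) → Atom L I → Atom L J
  mapA g (eqA i j)     = eqA (g i) (g j)
  mapA g (funA f is i) = funA f (Vec.map g is) (g i)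
  mapA g (relA r is)   = relA r (Vec.map g is)

  mapA-∘ : ∀ {I J K} {h : I → K} (g : J → K) (f : I → J) → h ≗ g ∘ f →
    ∀ t → mapA h t ≡ mapA g (mapA f t)
  mapA-∘ g f eq (eqA i j)     = cong₂ eqA (eq i) (eq j)
  mapA-∘ g f eq (funA s is i) = cong₂ (funA s) (trans (Vec.map-cong eq is) (Vec.map-∘ g f is)) (eq i)
  mapA-∘ g f eq (relA r is)   = cong (relA r) (trans (Vec.map-cong eq is) (Vec.map-∘ g f is))

  allVecs : ∀ r m → List (Vec (Fin r) m)
  allVecs r zero    = [] ∷ []
  allVecs r (suc m) = List.cartesianProductWith _∷_ (List.allFin r) (allVecs r m)

  ∈-allVecs : ∀ {r m} (v : Vec (Fin r) m) → v ∈ allVecs r m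
  ∈-allVecs []      = here refl
  ∈-allVecs (i ∷ v) = ∈-cartesianProductWith⁺ _∷_ (∈-allFin i) (∈-allVecs v)

  allAtoms : ∀ r → List (Atom L (Fin r))
  allAtoms r =
    List.cartesianProductWith eqA (List.allFin r) (List.allFin r) ++
    List.concatMap (λ f → List.cartesianProductWith (funA f) (allVecs r (funAr f)) (List.allFin r))
      (List.allFin nFun) ++
    List.concatMap (λ s → List.map (relA s) (allVecs r (relAr s))) (List.allFin nRel)

  ∈-allAtoms : ∀ {r} (t : Atom L (Fin r)) → t ∈ allAtoms r
  ∈-allAtoms (eqA i j) = ∈-++⁺ˡ (∈-cartesianProductWith⁺ eqA (∈-allFin i) (∈-allFin j))
  ∈-allAtoms {r} (funA f is i) =
    ∈-++⁺ʳ (List.cartesianProductWith eqA (List.allFin r) (List.allFin r)) (∈-++⁺ˡ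
      (∈-concatMap⁺ (λ f → List.cartesianProductWith (funA f) (allVecs r (funAr f)) (List.allFin r))
        (Any.map (λ { refl → ∈-cartesianProductWith⁺ (funA f) (∈-allVecs is) (∈-allFin i) })
          (∈-allFin f))))
  ∈-allAtoms {r} (relA s is) =
    ∈-++⁺ʳ (List.cartesianProductWith eqA (List.allFin r) (List.allFin r)) (∈-++⁺ʳ
      (List.concatMap (λ f → List.cartesianProductWith (funA f) (allVecs r (funAr f)) (List.allFin r))
        (List.allFin nFun))
      (∈-concatMap⁺ (λ s → List.map (relA s) (allVecs r (relAr s)))
        (Any.map (λ { refl → ∈-map⁺ (relA s) (∈-allVecs is) }) (∈-allFin s))))

module Game {L : Language} (𝔄 : Structure L) where
  open Structure 𝔄 renaming (Carrier to A)

  Holds : Atom L A → Set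
  Holds (eqA x y)     = x ≡ y
  Holds (funA f xs x) = funI f xs ≡ x
  Holds (relA r xs)   = relI r xs

  ext : ∀ {I : Set} → A → (I → A) → Maybe I → A
  ext c a = maybe′ a c

  -- Duplicator wins the n-round game from the positions a and b.
  Eqv : ℕ → {I : Set} → (I → A) → (I → A) → Set
  Eqv zero    a b = ∀ t → Holds (mapA a t) ⇔ Holds (mapA b t)
  Eqv (suc n) a b = (∀ c → Σ A λ d → Eqv n (ext c a) (ext d b)) ×
                    (∀ d → Σ A λ c → Eqv n (ext c a) (ext d b))

  -- The tool for every change of positions: `g` may drop, permute or repeat them. Pointwise
  -- equalities are allowed for, since the families that arise agree only pointwise.
  eqv-reindex : ∀ n {I J : Set} {a b : I → A} {a′ b′ : J → A} (g : J → I) →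
    a′ ≗ a ∘ g → b′ ≗ b ∘ g → Eqv n a b → Eqv n a′ b′
  eqv-reindex zero {a = a} {b} g p q e t =
    subst₂ (λ x y → Holds x ⇔ Holds y) (sym (mapA-∘ a g p t)) (sym (mapA-∘ b g q t)) (e (mapA g t))
  eqv-reindex (suc n) {I} {J} {a} {b} {a′} {b′} g p q (forth , back) =
    (λ c → let d , e = forth c in d , step c d e) , (λ d → let c , e = back d in c , step c d e)
    where
    g⁺ : Maybe J → Maybe I
    g⁺ (just j) = just (g j)
    g⁺ nothing  = nothing
    lift : ∀ {h : I → A} {h′ : J → A} c → h′ ≗ h ∘ g → ext c h′ ≗ ext c h ∘ g⁺
    lift c r (just j) = r j
    lift c r nothing  = refl
    step : ∀ c d → Eqv n (ext c a) (ext d b) → Eqv n (ext c a′) (ext d b′)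
    step c d = eqv-reindex n g⁺ (lift c p) (lift d q)

  eqv-refl : ∀ n {I : Set} (a : I → A) → Eqv n a a
  eqv-refl zero    a t = ⇔-id _
  eqv-refl (suc n) a   = (λ c → c , eqv-refl n (ext c a)) , (λ c → c , eqv-refl n (ext c a))

  eqv-sym : ∀ n {I : Set} {a b : I → A} → Eqv n a b → Eqv n b a
  eqv-sym zero    e t = ⇔-sym (e t)
  eqv-sym (suc n) (forth , back) =
    (λ c → let d , e = back c in d , eqv-sym n e) , (λ d → let c , e = forth d in c , eqv-sym n e)

  eqv-trans : ∀ n {I : Set} {a b c : I → A} → Eqv n a b → Eqv n b c → Eqv n a c
  eqv-trans zero    e e′ t = e′ t ⇔-∘ e t
  eqv-trans (suc n) (forth , back) (forth′ , back′) =
    (λ x → let y , e = forth x ; w , e′ = forth′ y in w , eqv-trans n e e′) ,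
    (λ w → let y , e′ = back′ w ; x , e = back y in x , eqv-trans n e e′)

  -- A round cannot be skipped, so Spoiler wastes it on an arbitrary `x₀`, whose position is then
  -- dropped.
  eqv-pred : A → ∀ n {I : Set} {a b : I → A} → Eqv (suc n) a b → Eqv n a b
  eqv-pred x₀ n {a = a} {b} (forth , _) =
    let d , e = forth x₀
    in eqv-reindex n {a = ext x₀ a} {b = ext d b} just (λ _ → refl) (λ _ → refl) e

  eqv-≤ : A → ∀ {m n} {I : Set} {a b : I → A} → m ≤ n → Eqv n a b → Eqv m a b
  eqv-≤ x₀ {m} {I = I} {a} {b} m≤n = go (≤⇒≤′ m≤n)
    where
    go : ∀ {n} → m ≤′ n → Eqv n a b → Eqv m a b
    go (≤′-reflexive refl) e = e
    go (≤′-step {n} p)     e = go p (eqv-pred x₀ n e)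

  -- Spoiler plays the `z k` with `k < B` on the right and the replies are the `y k`: a finite piece
  -- of `z` is copied to the left at the price of `B` rounds.
  eqv-extend : ∀ B n {I : Set} {a b : I → A} (z : ℕ → A) → Eqv (B + n) a b →
    Σ (ℕ → A) λ y → Eqv n {I ⊎ Σ ℕ (_< B)} [ a , y ∘ proj₁ ]′ [ b , z ∘ proj₁ ]′
  eqv-extend zero n z e =
    z , eqv-reindex n [ id , (λ ()) ]′ (λ { (inj₁ _) → refl ; (inj₂ (_ , ())) })
      (λ { (inj₁ _) → refl ; (inj₂ (_ , ())) }) e
  eqv-extend (suc B) n {I} {a} {b} z (_ , back) with back (z B)
  ... | c , e with eqv-extend B n z e
  ...   | y , e′ = y⁺ , eqv-reindex n g p q e′
    where
    pick : ∀ k → Dec (k ≡ B) → A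
    pick k (yes _) = c
    pick k (no _)  = y k
    y⁺ : ℕ → A
    y⁺ k = pick k (k ≟ B)
    g′ : ∀ k → k < suc B → Dec (k ≡ B) → Maybe I ⊎ Σ ℕ (_< B)
    g′ k k< (yes _) = inj₁ nothing
    g′ k k< (no k≢) = inj₂ (k , ≤∧≢⇒< (s≤s⁻¹ k<) k≢)
    g : I ⊎ Σ ℕ (_< suc B) → Maybe I ⊎ Σ ℕ (_< B)
    g (inj₁ i)        = inj₁ (just i)
    g (inj₂ (k , k<)) = g′ k k< (k ≟ B)
    p : [ a , y⁺ ∘ proj₁ ]′ ≗ [ ext c a , y ∘ proj₁ ]′ ∘ g
    p (inj₁ i) = refl
    p (inj₂ (k , k<)) with k ≟ B
    ... | yes _ = refl
    ... | no  _ = refl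
    q : [ b , z ∘ proj₁ ]′ ≗ [ ext (z B) b , z ∘ proj₁ ]′ ∘ g
    q (inj₁ i) = refl
    q (inj₂ (k , k<)) with k ≟ B
    ... | yes refl = refl
    ... | no  _    = refl

  -- Finite index of the game equivalence.

  module _ (em : ExcludedMiddle 0ℓ) where

    -- The cells of the partition generated by the given predicates.
    signatures : ∀ {T : Set} → List (T → Set) → List (T → Set)
    signatures []       = (λ _ → ⊤) ∷ []
    signatures (D ∷ Ds) = List.map (λ S t → D t × S t) (signatures Ds) ++
                          List.map (λ S t → ¬ D t × S t) (signatures Ds)

    signature-of : ∀ {T : Set} (Ds : List (T → Set)) t →
      Σ (T → Set) λ S → S ∈ signatures Ds × S t × (∀ u → S u → All (λ D → D t ⇔ D u) Ds)
    signature-of [] t = _ , here refl , tt , λ _ _ → []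
    signature-of (D ∷ Ds) t with signature-of Ds t | em {D t}
    ... | S , S∈ , St , agree | yes Dt =
      _ , ∈-++⁺ˡ (∈-map⁺ (λ S t → D t × S t) S∈) , (Dt , St) ,
      λ { u (Du , Su) → mk⇔ (λ _ → Du) (λ _ → Dt) ∷ agree u Su }
    ... | S , S∈ , St , agree | no ¬Dt =
      _ , ∈-++⁺ʳ (List.map (λ S t → D t × S t) (signatures Ds)) (∈-map⁺ (λ S t → ¬ D t × S t) S∈) ,
      (¬Dt , St) ,
      λ { u (¬Du , Su) → mk⇔ (⊥-elim ∘ ¬Dt) (⊥-elim ∘ ¬Du) ∷ agree u Su }

    -- Fraïssé's argument in semantic form. For one more round the predicates say that some
    -- extension of the tuple lies in a given cell of the partition for `n` rounds on tuples longer
    -- by one. They become the colourings in Ramsey's theorem, to which only their number matters.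
    finite-index : ∀ n r → Σ (List (Vec A r → Set)) λ Ds →
      ∀ u v → All (λ D → D u ⇔ D v) Ds → Eqv n (Vec.lookup u) (Vec.lookup v)
    finite-index zero r =
      List.map (λ t u → Holds (mapA (Vec.lookup u) t)) (allAtoms r) ,
      λ u v agree t → All.lookup agree (∈-map⁺ (λ t u → Holds (mapA (Vec.lookup u) t)) (∈-allAtoms t))
    finite-index (suc n) r with finite-index n (suc r)
    ... | Ds , agree⇒eqv = List.map some (signatures Ds) , λ u v agree →
      (λ c → answer u v (λ S∈ → to (All.lookup agree (∈-map⁺ some S∈))) c) ,
      (λ d → let c , e = answer v u (λ S∈ → from (All.lookup agree (∈-map⁺ some S∈))) d
             in c , eqv-sym n e)
      where
      some : (Vec A (suc r) → Set) → Vec A r → Set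
      some S u = Σ A λ c → S (c ∷ u)
      g : Maybe (Fin r) → Fin (suc r)
      g (just i) = suc i
      g nothing  = zero
      unfold : ∀ c (u : Vec A r) → ext c (Vec.lookup u) ≗ Vec.lookup (c ∷ u) ∘ g
      unfold c u (just i) = refl
      unfold c u nothing  = refl
      answer : ∀ u v → (∀ {S} → S ∈ signatures Ds → some S u → some S v) →
        ∀ c → Σ A λ d → Eqv n (ext c (Vec.lookup u)) (ext d (Vec.lookup v))
      answer u v move c with signature-of Ds (c ∷ u)
      ... | S , S∈ , Su , agree with move S∈ (c , Su)
      ...   | d , Sv = d , eqv-reindex n g (unfold c u) (unfold d v)
                           (agree⇒eqv (c ∷ u) (d ∷ v) (agree (d ∷ v) Sv))

-- Recursive functions

record Comp {k} (f : Vec ℕ k → ℕ) : Set where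
  constructor _,_
  field
    program : PR k
    correct : ∀ xs → Eval program xs (f xs)

record CompV {k m} (F : Vec ℕ k → Vec ℕ m) : Set where
  constructor _,_
  field
    programs : Vec (PR k) m
    correct  : ∀ xs → EvalAll programs xs (F xs)

comp-ext : ∀ {k} {f g : Vec ℕ k → ℕ} → f ≗ g → Comp f → Comp g
comp-ext eq (e , ev) = e , λ xs → subst (Eval e xs) (eq xs) (ev xs)

infixr 5 _∷ᶜ_

[]ᶜ : ∀ {k} → CompV {k} (λ _ → [])
[]ᶜ = [] , λ _ → []

_∷ᶜ_ : ∀ {k m} {f : Vec ℕ k → ℕ} {F : Vec ℕ k → Vec ℕ m} →
  Comp f → CompV F → CompV (λ xs → f xs ∷ F xs)
(e , ev) ∷ᶜ (es , evs) = e ∷ es , λ xs → ev xs ∷ evs xs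

comp-∘ : ∀ {k m} {g : Vec ℕ m → ℕ} {F : Vec ℕ k → Vec ℕ m} →
  Comp g → CompV F → Comp (λ xs → g (F xs))
comp-∘ (e , ev) (es , evs) = Cc e es , λ xs → evC (evs xs) (ev _)

comp-lookup : ∀ {k} (i : Fin k) → Comp (λ xs → lookupV xs i)
comp-lookup i = Pc i , λ xs → evP i

comp-select : ∀ {k m} (s : Fin m → Fin k) {F : Vec ℕ k → Vec ℕ m} →
  (∀ xs i → lookupV xs (s i) ≡ lookupV (F xs) i) → CompV F
comp-select {m = zero} s {F} eq = [] , λ xs → empty (F xs)
  where
  empty : ∀ {k} {xs : Vec ℕ k} (ys : Vec ℕ 0) → EvalAll [] xs ys
  empty [] = []
comp-select {k} {suc m} s {F} eq with comp-select (s ∘ suc) {Vec.tail ∘ F} eq′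
  where
  eq′ : ∀ xs i → lookupV xs (s (suc i)) ≡ lookupV (Vec.tail (F xs)) i
  eq′ xs i with F xs | eq xs (suc i)
  ... | y ∷ ys | p = p
... | es , evs = Pc (s zero) ∷ es , λ xs → join (F xs) (eq xs zero) (evs xs)
  where
  join : ∀ {xs : Vec ℕ k} (ys : Vec ℕ (suc m)) → lookupV xs (s zero) ≡ lookupV ys zero →
    EvalAll es xs (Vec.tail ys) → EvalAll (Pc (s zero) ∷ es) xs ys
  join {xs} (y ∷ ys) p e = subst (Eval (Pc (s zero)) xs) p (evP (s zero)) ∷ e

comp-id : ∀ {k} → CompV {k} id
comp-id = comp-select id λ _ _ → refl

comp-tail : ∀ {k} → CompV {suc k} Vec.tail
comp-tail = comp-select suc λ { (_ ∷ _) _ → refl }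

comp-const : ∀ {k} n → Comp {k} (λ _ → n)
comp-const zero    = Zc , λ _ → evZ
comp-const (suc n) with comp-const n
... | e , ev = Cc Sc (e ∷ []) , λ xs → evC (ev xs ∷ []) evS

comp-suc : ∀ {k} {f : Vec ℕ k → ℕ} → Comp f → Comp (λ xs → suc (f xs))
comp-suc f = comp-∘ {g = λ xs → suc (lookupV xs zero)} (Sc , λ { (_ ∷ []) → evS }) (f ∷ᶜ []ᶜ)

comp-rec : ∀ {k} {f : Vec ℕ (suc k) → ℕ} {g : Vec ℕ k → ℕ} {h : Vec ℕ (suc (suc k)) → ℕ} →
  (∀ xs → f (0 ∷ xs) ≡ g xs) → (∀ n xs → f (suc n ∷ xs) ≡ h (n ∷ f (n ∷ xs) ∷ xs)) →
  Comp g → Comp h → Comp f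
comp-rec {f = f} {g} {h} f0 fs (eg , evg) (eh , evh) = Rc eg eh , λ { (n ∷ xs) → go n xs }
  where
  go : ∀ n xs → Eval (Rc eg eh) (n ∷ xs) (f (n ∷ xs))
  go zero    xs = subst (Eval (Rc eg eh) (0 ∷ xs)) (sym (f0 xs)) (evR0 (evg xs))
  go (suc n) xs = subst (Eval (Rc eg eh) (suc n ∷ xs)) (sym (fs n xs)) (evRs (go n xs) (evh _))

pattern #0 = zero
pattern #1 = suc zero
pattern #2 = suc (suc zero)

comp-+ : ∀ {k} {f g : Vec ℕ k → ℕ} → Comp f → Comp g → Comp (λ xs → f xs + g xs)
comp-+ f g = comp-∘ {g = λ v → lookupV v #0 + lookupV v #1}
  (comp-rec (λ { (_ ∷ []) → refl }) (λ { _ (_ ∷ []) → refl })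
    (comp-lookup #0) (comp-suc (comp-lookup #1)))
  (f ∷ᶜ g ∷ᶜ []ᶜ)

comp-pred : ∀ {k} {f : Vec ℕ k → ℕ} → Comp f → Comp (λ xs → pred (f xs))
comp-pred f = comp-∘ {g = λ v → pred (lookupV v #0)}
  (comp-rec {h = λ v → lookupV v #0} (λ _ → refl) (λ _ _ → refl) (comp-const 0) (comp-lookup #0))
  (f ∷ᶜ []ᶜ)

comp-∸ : ∀ {k} {f g : Vec ℕ k → ℕ} → Comp f → Comp g → Comp (λ xs → f xs ∸ g xs)
comp-∸ f g = comp-∘ {g = λ v → lookupV v #1 ∸ lookupV v #0}
  (comp-rec {g = λ v → lookupV v #0} {h = λ v → pred (lookupV v #1)}
    (λ _ → refl) (λ { n (x ∷ []) → sym (pred[m∸n]≡m∸[1+n] x n) })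
    (comp-lookup #0) (comp-pred (comp-lookup #1)))
  (g ∷ᶜ f ∷ᶜ []ᶜ)

ifZero : ℕ → ℕ → ℕ → ℕ
ifZero zero    x y = x
ifZero (suc _) x y = y

comp-ifZero : ∀ {k} {f g h : Vec ℕ k → ℕ} → Comp f → Comp g → Comp h →
  Comp (λ xs → ifZero (f xs) (g xs) (h xs))
comp-ifZero f g h = comp-∘ {g = λ v → ifZero (lookupV v #0) (lookupV v #1) (lookupV v #2)}
  (comp-rec {g = λ v → lookupV v #0} {h = λ v → lookupV v (suc #2)}
    (λ { (_ ∷ _ ∷ []) → refl }) (λ { _ (_ ∷ _ ∷ []) → refl }) (comp-lookup #0) (comp-lookup (suc #2)))
  (f ∷ᶜ g ∷ᶜ h ∷ᶜ []ᶜ)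

dist : ℕ → ℕ → ℕ
dist m n = (m ∸ n) + (n ∸ m)

dist-self : ∀ n → dist n n ≡ 0
dist-self n = cong₂ _+_ (n∸n≡0 n) (n∸n≡0 n)

dist≡0 : ∀ {m n} → dist m n ≡ 0 → m ≡ n
dist≡0 {m} {n} eq = ≤-antisym (m∸n≡0⇒m≤n (m+n≡0⇒m≡0 (m ∸ n) eq)) (m∸n≡0⇒m≤n (m+n≡0⇒n≡0 (m ∸ n) eq))

-- The result 0 means success, as in `RecursiveSet`.
search : (ℕ → ℕ) → ℕ → ℕ → ℕ
search f c zero    = 1
search f c (suc n) = ifZero (dist (f n) c) 0 (search f c n)

search-spec : ∀ f c n → (Σ ℕ (λ k → k < n × f k ≡ c) × search f c n ≡ 0) ⊎
                        (¬ Σ ℕ (λ k → k < n × f k ≡ c) × search f c n ≡ 1)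
search-spec f c zero = inj₂ ((λ ()) , refl)
search-spec f c (suc n) with dist (f n) c in eq
... | zero = inj₁ ((n , ≤-refl , dist≡0 eq) , refl)
... | suc _ with search-spec f c n
...   | inj₁ ((k , k< , fk) , s) = inj₁ ((k , m≤n⇒m≤1+n k< , fk) , s)
...   | inj₂ (none , s) = inj₂ (none′ , s)
  where
  none′ : ¬ Σ ℕ (λ k → k < suc n × f k ≡ c)
  none′ (k , k< , fk) with k ≟ n
  ... | yes refl = 0≢1+n (trans (sym (dist-self c)) (trans (cong (λ x → dist x c) (sym fk)) eq))
  ... | no k≢n   = none (k , ≤∧≢⇒< (s≤s⁻¹ k<) k≢n , fk)

-- By `n ≤ f n` a solution of `f n ≡ c` is at most `c`, so a bounded search decides the range. As in
-- Craig's trick, the formulas are padded to satisfy this hypothesis.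
range-recursive : (f : ℕ → ℕ) → (∀ n → n ≤ f n) → Comp {1} (λ v → f (lookupV v #0)) →
  RecursiveSet (λ c → Σ ℕ λ n → f n ≡ c)
range-recursive f n≤f f-comp = program decide , λ c → answer c (correct decide (c ∷ []))
  where
  open Comp
  searched : Comp {2} (λ v → search f (lookupV v #1) (lookupV v #0))
  searched = comp-rec {g = λ _ → 1}
    {h = λ v → ifZero (dist (f (lookupV v #0)) (lookupV v #2)) 0 (lookupV v #1)}
    (λ _ → refl) (λ { _ (_ ∷ []) → refl }) (comp-const 1)
    (comp-ifZero (comp-+ (comp-∸ f₀ (comp-lookup #2)) (comp-∸ (comp-lookup #2) f₀))
      (comp-const 0) (comp-lookup #1))
    where
    f₀ : Comp {3} (λ v → f (lookupV v #0))
    f₀ = comp-∘ f-comp (comp-lookup #0 ∷ᶜ []ᶜ)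
  decide : Comp {1} (λ v → search f (lookupV v #0) (suc (lookupV v #0)))
  decide = comp-∘ searched (comp-suc (comp-lookup #0) ∷ᶜ comp-lookup #0 ∷ᶜ []ᶜ)
  answer : ∀ c → Eval (program decide) (c ∷ []) (search f c (suc c)) →
    ((Σ ℕ λ n → f n ≡ c) × Eval (program decide) (c ∷ []) 0) ⊎
    (¬ (Σ ℕ λ n → f n ≡ c) × Eval (program decide) (c ∷ []) 1)
  answer c ev with search-spec f c (suc c)
  ... | inj₁ ((k , _ , fk) , s) = inj₁ ((k , fk) , subst (Eval _ _) s ev)
  ... | inj₂ (none , s) =
    inj₂ ((λ { (k , fk) → none (k , s≤s (subst (k ≤_) fk (n≤f k)) , fk) }) , subst (Eval _ _) s ev)

-- Formulas and their codes

-- (j , l) stands for the term t_j applied to the list of points l.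
Idx : Set → Set
Idx P = ℕ × List P

mapIdx : ∀ {P P′ : Set} → (P → P′) → Idx P → Idx P′
mapIdx f (j , l) = j , List.map f l

module TypeFormulas (L : Language) where
  open Language L
  open Syntax L

  n≤tri : ∀ n → n ≤ tri n
  n≤tri zero    = z≤n
  n≤tri (suc n) = m≤m+n (suc n) (tri n)

  tri-mono : ∀ {m n} → m ≤ n → tri m ≤ tri n
  tri-mono z≤n       = z≤n
  tri-mono (s≤s m≤n) = s≤s (+-mono-≤ m≤n (tri-mono m≤n))

  pair-mono : ∀ {a b c d} → a ≤ c → b ≤ d → pair a b ≤ pair c d
  pair-mono a≤c b≤d = +-mono-≤ (tri-mono (+-mono-≤ a≤c b≤d)) b≤d

  m≤pair : ∀ m n → m ≤ pair m n
  m≤pair m n = ≤-trans (m≤m+n m n) (≤-trans (n≤tri (m + n)) (m≤m+n _ n))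

  n≤pair : ∀ m n → n ≤ pair m n
  n≤pair m n = m≤n+m n (tri (m + n))

  -- The pairs with sum s have codes from `tri s` up to, but excluding, `tri (suc s)`; hence a
  -- larger sum forces a larger code.
  pair-sum-≤ : ∀ a b c d → pair a b ≡ pair c d → c + d ≤ a + b
  pair-sum-≤ a b c d eq = ≮⇒≥ λ lt → <-irrefl eq (begin-strict
    tri (a + b) + b            ≤⟨ +-monoʳ-≤ (tri (a + b)) (m≤n+m b a) ⟩
    tri (a + b) + (a + b)      <⟨ ≤-reflexive (cong suc (+-comm (tri (a + b)) (a + b))) ⟩
    tri (suc (a + b))          ≤⟨ tri-mono lt ⟩
    tri (c + d)                ≤⟨ m≤m+n (tri (c + d)) d ⟩
    tri (c + d) + d            ∎)
    where open ≤-Reasoning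

  pair-injective : ∀ {a b c d} → pair a b ≡ pair c d → a ≡ c × b ≡ d
  pair-injective {a} {b} {c} {d} eq = +-cancelʳ-≡ d a c (trans (cong (_+_ a) (sym b≡d)) sum≡) , b≡d
    where
    sum≡ : a + b ≡ c + d
    sum≡ = ≤-antisym (pair-sum-≤ c d a b (sym eq)) (pair-sum-≤ a b c d eq)
    b≡d : b ≡ d
    b≡d = +-cancelˡ-≡ (tri (a + b)) b d (trans eq (cong (λ s → tri s + d) (sym sum≡)))

  codeList : List ℕ → ℕ
  codeList []      = 0
  codeList (x ∷ l) = suc (pair x (codeList l))

  codeIdx : Idx ℕ → ℕ
  codeIdx (j , l) = pair j (codeList l)

  codeList-injective : ∀ l l′ → codeList l ≡ codeList l′ → l ≡ l′
  codeList-injective []      []       _  = refl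
  codeList-injective (x ∷ l) (y ∷ l′) eq with pair-injective (suc-injective eq)
  ... | x≡y , eq′ = cong₂ _∷_ x≡y (codeList-injective l l′ eq′)

  codeIdx-injective : ∀ {e e′} → codeIdx e ≡ codeIdx e′ → e ≡ e′
  codeIdx-injective {_ , l} {_ , l′} eq with pair-injective eq
  ... | j≡j′ , eq′ = cong₂ _,_ j≡j′ (codeList-injective l l′ eq′)

  comp-tri : ∀ {k} {f : Vec ℕ k → ℕ} → Comp f → Comp (λ xs → tri (f xs))
  comp-tri f = comp-∘ {g = λ v → tri (lookupV v #0)}
    (comp-rec {h = λ v → suc (lookupV v #0) + lookupV v #1} (λ _ → refl) (λ _ _ → refl)
      (comp-const 0) (comp-+ (comp-suc (comp-lookup #0)) (comp-lookup #1)))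
    (f ∷ᶜ []ᶜ)

  comp-pair : ∀ {k} {f g : Vec ℕ k → ℕ} → Comp f → Comp g → Comp (λ xs → pair (f xs) (g xs))
  comp-pair f g = comp-+ (comp-tri (comp-+ f g)) g

  record CompF {k} (F : Vec ℕ k → Formula) : Set where
    constructor coded
    field
      code-comp : Comp (λ xs → code (F xs))
  open CompF

  ⊤' : Formula
  ⊤' = ⊥' ⇒' ⊥'

  infix 4 _⇔'_
  _⇔'_ : Formula → Formula → Formula
  φ ⇔' ψ = (φ ⇒' ψ) ∧' (ψ ⇒' φ)

  bigAnd : ℕ → (ℕ → Formula) → Formula
  bigAnd zero    F = ⊤'
  bigAnd (suc n) F = F n ∧' bigAnd n F

  andFin : ∀ n → (Fin n → Formula) → Formula
  andFin zero    F = ⊤'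
  andFin (suc n) F = F zero ∧' andFin n (F ∘ suc)

  block∃ : ℕ → ℕ → Formula → Formula
  block∃ b zero    φ = φ
  block∃ b (suc n) φ = ∃' (b + n) (block∃ b n φ)

  -- The block is long enough to bind every variable of φ from b on, and to make the code at least N.
  close∃ : ℕ → ℕ → Formula → Formula
  close∃ b N φ = block∃ b (suc (N + code φ)) φ

  N≤code-close∃ : ∀ b N φ → N ≤ code (close∃ b N φ)
  N≤code-close∃ b N φ = ≤-trans (≤-trans (m≤m+n N _) (m≤n+m (N + code φ) b))
    (≤-trans (m≤pair _ _) (n≤pair 8 _))

  -- Nested conjunctions over a context that grows at its head; the bound of each new entry is
  -- the entry of the context at the given position.
  loop : (∀ m → Fin (suc m)) → ∀ m → (Vec ℕ (suc m) → Formula) → Vec ℕ 1 → Formula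
  loop s zero    F = F
  loop s (suc m) F = loop s m λ ctx → bigAnd (lookupV ctx (s m)) λ x → F (x ∷ ctx)

  -- With `firstPos` each new entry lies below the preceding one, so the contexts are the increasing
  -- sequences below N; with `lastPos` every entry is bounded by N only, so they are all tuples
  -- below N.
  firstPos lastPos : ∀ m → Fin (suc m)
  firstPos m = zero
  lastPos  m = fromℕ m

  end : ∀ {m} → Vec ℕ (suc m) → ℕ
  end {m} ctx = lookupV ctx (lastPos m)

  initial : ∀ {m} → Vec ℕ (suc m) → Vec ℕ m
  initial (x ∷ [])     = []
  initial (x ∷ y ∷ ys) = x ∷ initial (y ∷ ys)

  vars : ∀ {m} → ℕ → Vec ℕ m → Vec Term m
  vars s = Vec.map (λ i → var (s + i))

  atomFormula : ℕ → Atom L ℕ → Formula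
  atomFormula s (eqA i j)     = var (s + i) ≐ var (s + j)
  atomFormula s (funA f is i) = app f (vars s is) ≐ var (s + i)
  atomFormula s (relA r is)   = rel r (vars s is)

  agree : ℕ → Atom L ℕ → Formula
  agree T t = atomFormula 0 t ⇔' atomFormula T t

  eqAtom : Vec ℕ 3 → Formula
  eqAtom ctx = agree (end ctx) (eqA (lookupV ctx #0) (lookupV ctx #1))

  funAtom : ∀ f → Vec ℕ (suc (suc (funAr f))) → Formula
  funAtom f ctx = agree (end ctx) (funA f (initial (Vec.tail ctx)) (lookupV ctx #0))

  relAtom : ∀ r → Vec ℕ (suc (relAr r)) → Formula
  relAtom r ctx = agree (end ctx) (relA r (initial ctx))

  atomsF : Vec ℕ 1 → Formula
  atomsF ctx = loop lastPos 2 eqAtom ctx ∧'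
    (andFin nFun (λ f → loop lastPos (suc (funAr f)) (funAtom f) ctx) ∧'
     andFin nRel (λ r → loop lastPos (relAr r) (relAtom r) ctx))

  -- The n-round game on the positions k ↦ (variable k , variable T + k) for the k < T outside
  -- [ R , R + n ); these remaining k are used up by the moves.
  eqF : ℕ → ℕ → ℕ → Formula
  eqF R zero    T = atomsF (T ∷ [])
  eqF R (suc n) T = ∀' (R + n) (∃' (T + (R + n)) (eqF R n T)) ∧'
                    ∀' (T + (R + n)) (∃' (R + n) (eqF R n T))

  -- The formula for a context x₁ < … < xₘ < N speaks about the value i in variable i for i < R, its
  -- partner in the game in variable T + i, and the array element with code c in variable T + (T + c),
  -- where T = R + N exceeds the index of every variable for a value or a first component of a move.
  module _ {R m} (S : Vec (Idx (Fin (suc m))) R) where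

    top : ∀ {k} → Vec ℕ (suc k) → ℕ
    top ctx = R + end ctx

    arrayVar : ∀ {k} → Vec ℕ (suc k) → Idx (Fin (suc k)) → ℕ
    arrayVar ctx e = top ctx + (top ctx + codeIdx (mapIdx (lookupV ctx) e))

    distinctF : Vec ℕ 3 → Formula
    distinctF ctx = ¬' (var (arrayVar ctx (0 , #0 ∷ [])) ≐ var (arrayVar ctx (0 , #1 ∷ [])))

    -- `eqF` expects partners at the uniform distance T, whereas the sampled array elements sit at
    -- variables given by their codes; the existential block copies them into place.
    matchF : Vec ℕ (suc m) → Formula
    matchF ctx = block∃ (top ctx) R
      (andFin R (λ i → var (top ctx + toℕ i) ≐ var (arrayVar ctx (Vec.lookup S i))) ∧'
       eqF R (end ctx) (top ctx))

    bodyF : Vec ℕ 1 → Formula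
    bodyF ctx = loop firstPos 2 distinctF ctx ∧' loop firstPos m matchF ctx

  -- Computability of the codes of these formulas.

  comp-tagged : ∀ {k} n {f : Vec ℕ k → ℕ} → Comp f → Comp (λ xs → pair n (f xs))
  comp-tagged n f = comp-pair (comp-const n) f

  compF-∧ : ∀ {k} {F G : Vec ℕ k → Formula} → CompF F → CompF G → CompF (λ xs → F xs ∧' G xs)
  compF-∧ (coded F) (coded G) = coded (comp-tagged 4 (comp-pair F G))

  compF-⇒ : ∀ {k} {F G : Vec ℕ k → Formula} → CompF F → CompF G → CompF (λ xs → F xs ⇒' G xs)
  compF-⇒ (coded F) (coded G) = coded (comp-tagged 6 (comp-pair F G))

  compF-¬ : ∀ {k} {F : Vec ℕ k → Formula} → CompF F → CompF (λ xs → ¬' F xs)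
  compF-¬ (coded F) = coded (comp-tagged 3 F)

  compF-≐ : ∀ {k} {s t : Vec ℕ k → Term} → Comp (λ xs → codeT (s xs)) → Comp (λ xs → codeT (t xs)) →
    CompF (λ xs → s xs ≐ t xs)
  compF-≐ s t = coded (comp-tagged 1 (comp-pair s t))

  comp-var : ∀ {k} {f : Vec ℕ k → ℕ} → Comp f → Comp (λ xs → codeT (var (f xs)))
  comp-var f = comp-tagged 0 f

  compF-⊤ : ∀ {k} → CompF {k} (λ _ → ⊤')
  compF-⊤ = coded (comp-const _)

  compF-∘ : ∀ {k m} {F : Vec ℕ m → Formula} {G : Vec ℕ k → Vec ℕ m} → CompF F → CompV G →
    CompF (λ xs → F (G xs))
  compF-∘ (coded F) G = coded (comp-∘ F G)

  comp-tail² : ∀ {k} → CompV {suc (suc k)} (λ v → Vec.tail (Vec.tail v))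
  comp-tail² = comp-select (λ i → suc (suc i)) λ { (_ ∷ _ ∷ _) _ → refl }

  compF-bigAnd : ∀ {k} {b : Vec ℕ k → ℕ} {F : Vec ℕ (suc k) → Formula} → Comp b → CompF F →
    CompF (λ xs → bigAnd (b xs) (λ x → F (x ∷ xs)))
  compF-bigAnd {F = F} b F-comp = compF-∘
    {F = λ v → bigAnd (lookupV v #0) (λ x → F (x ∷ Vec.tail v))}
    (coded (comp-rec
      {h = λ v → pair 4 (pair (code (F (lookupV v #0 ∷ Vec.tail (Vec.tail v)))) (lookupV v #1))}
      (λ _ → refl) (λ _ _ → refl) (code-comp compF-⊤)
      (comp-tagged 4 (comp-pair
        (comp-∘ (code-comp F-comp) (comp-lookup #0 ∷ᶜ comp-tail²)) (comp-lookup #1)))))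
    (b ∷ᶜ comp-id)

  compF-andFin : ∀ {k} n {F : Vec ℕ k → Fin n → Formula} → (∀ i → CompF (λ xs → F xs i)) →
    CompF (λ xs → andFin n (F xs))
  compF-andFin zero    F = compF-⊤
  compF-andFin (suc n) F = compF-∧ (F zero) (compF-andFin n (λ i → F (suc i)))

  compF-block∃ : ∀ {k} {b n : Vec ℕ k → ℕ} {F : Vec ℕ k → Formula} → Comp b → Comp n → CompF F →
    CompF (λ xs → block∃ (b xs) (n xs) (F xs))
  compF-block∃ {b = b} {F = F} b-comp n F-comp = compF-∘
    {F = λ v → block∃ (b (Vec.tail v)) (lookupV v #0) (F (Vec.tail v))}
    (coded (comp-rec
      {h = λ v → pair 8 (pair (b (Vec.tail (Vec.tail v)) + lookupV v #0) (lookupV v #1))}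
      (λ _ → refl) (λ _ _ → refl) (code-comp F-comp)
      (comp-tagged 8 (comp-pair
        (comp-+ (comp-∘ b-comp comp-tail²) (comp-lookup #0)) (comp-lookup #1)))))
    (n ∷ᶜ comp-id)

  compF-loop : ∀ s m {F : Vec ℕ (suc m) → Formula} → CompF F → CompF (loop s m F)
  compF-loop s zero    F = F
  compF-loop s (suc m) F = compF-loop s m (compF-bigAnd (comp-lookup (s m)) F)

  comp-vars : ∀ m → Comp {suc m} (λ v → codeTs (vars (lookupV v #0) (Vec.tail v)))
  comp-vars zero    = comp-ext (λ { (_ ∷ []) → refl }) (comp-const 0)
  comp-vars (suc m) = comp-ext (λ { (_ ∷ _ ∷ _) → refl })
    (comp-suc (comp-pair (comp-var (comp-+ (comp-lookup #0) (comp-lookup #1)))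
      (comp-∘ (comp-vars m) (comp-lookup #0 ∷ᶜ comp-tail²))))

  lookup-initial : ∀ {m} (xs : Vec ℕ (suc m)) i →
    lookupV xs (inject₁ i) ≡ lookupV (initial xs) i
  lookup-initial (x ∷ y ∷ ys) zero    = refl
  lookup-initial (x ∷ y ∷ ys) (suc i) = lookup-initial (y ∷ ys) i

  comp-initial : ∀ m → CompV {suc m} initial
  comp-initial m = comp-select inject₁ lookup-initial

  module _ {k} {s : Vec ℕ k → ℕ} (s-comp : Comp s) where

    compF-eqA : ∀ {i j : Vec ℕ k → ℕ} → Comp i → Comp j →
      CompF (λ xs → atomFormula (s xs) (eqA (i xs) (j xs)))
    compF-eqA i j = compF-≐ (comp-var (comp-+ s-comp i)) (comp-var (comp-+ s-comp j))

    compF-funA : ∀ f {is : Vec ℕ k → Vec ℕ (funAr f)} {i : Vec ℕ k → ℕ} → CompV is → Comp i →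
      CompF (λ xs → atomFormula (s xs) (funA f (is xs) (i xs)))
    compF-funA f is i = compF-≐
      (comp-tagged 1 (comp-tagged (toℕ f) (comp-∘ (comp-vars (funAr f)) (s-comp ∷ᶜ is))))
      (comp-var (comp-+ s-comp i))

    compF-relA : ∀ r {is : Vec ℕ k → Vec ℕ (relAr r)} → CompV is →
      CompF (λ xs → atomFormula (s xs) (relA r (is xs)))
    compF-relA r is =
      coded (comp-tagged 2 (comp-tagged (toℕ r) (comp-∘ (comp-vars (relAr r)) (s-comp ∷ᶜ is))))

  compF-agree : ∀ {k} {T : Vec ℕ k → ℕ} {t : Vec ℕ k → Atom L ℕ} →
    CompF (λ xs → atomFormula 0 (t xs)) → CompF (λ xs → atomFormula (T xs) (t xs)) →
    CompF (λ xs → agree (T xs) (t xs))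
  compF-agree F G = compF-∧ (compF-⇒ F G) (compF-⇒ G F)

  compF-atomsF : CompF atomsF
  compF-atomsF = compF-∧
    (compF-loop lastPos 2 (compF-agree {t = λ ctx → eqA (lookupV ctx #0) (lookupV ctx #1)}
      (compF-eqA (comp-const 0) (comp-lookup #0) (comp-lookup #1))
      (compF-eqA (comp-lookup (lastPos 2)) (comp-lookup #0) (comp-lookup #1))))
    (compF-∧
      (compF-andFin nFun λ f → compF-loop lastPos (suc (funAr f))
        (compF-agree {t = λ ctx → funA f (initial (Vec.tail ctx)) (lookupV ctx #0)}
          (compF-funA (comp-const 0) f (args f) (comp-lookup #0))
          (compF-funA (comp-lookup (lastPos (suc (funAr f)))) f (args f) (comp-lookup #0))))
      (compF-andFin nRel λ r → compF-loop lastPos (relAr r)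
        (compF-agree {t = λ ctx → relA r (initial ctx)}
          (compF-relA (comp-const 0) r (comp-initial _))
          (compF-relA (comp-lookup (lastPos (relAr r))) r (comp-initial _)))))
    where
    args : ∀ f → CompV {suc (suc (funAr f))} (λ ctx → initial (Vec.tail ctx))
    args f = comp-select (suc ∘ inject₁) {λ ctx → initial (Vec.tail ctx)}
      λ { (x ∷ xs) i → lookup-initial xs i }

  -- A formula transformer that acts computably on codes. The recursion for `eqF` wraps quantifiers
  -- around its previous value, and a primitive recursion knows that value only through its code.
  record CompT {k} (H : Vec ℕ k → Formula → Formula) : Set where
    field
      codeMap  : Vec ℕ k → ℕ → ℕ
      code-map : ∀ xs φ → code (H xs φ) ≡ codeMap xs (code φ)
      map-comp : Comp {suc k} (λ v → codeMap (Vec.tail v) (lookupV v #0))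
  open CompT

  compT-id : ∀ {k} → CompT {k} (λ _ φ → φ)
  compT-id = record
    { codeMap = λ _ c → c ; code-map = λ _ _ → refl ; map-comp = comp-lookup #0 }

  compT-∧ : ∀ {k} {H K : Vec ℕ k → Formula → Formula} → CompT H → CompT K →
    CompT (λ xs φ → H xs φ ∧' K xs φ)
  compT-∧ H K = record
    { codeMap  = λ xs c → pair 4 (pair (codeMap H xs c) (codeMap K xs c))
    ; code-map = λ xs φ → cong₂ (λ c d → pair 4 (pair c d)) (code-map H xs φ) (code-map K xs φ)
    ; map-comp = comp-tagged 4 (comp-pair (map-comp H) (map-comp K)) }

  compT-∀ : ∀ {k} {f : Vec ℕ k → ℕ} {H : Vec ℕ k → Formula → Formula} → Comp f → CompT H →
    CompT (λ xs φ → ∀' (f xs) (H xs φ))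
  compT-∀ {f = f} f-comp H = record
    { codeMap  = λ xs c → pair 7 (pair (f xs) (codeMap H xs c))
    ; code-map = λ xs φ → cong (λ c → pair 7 (pair (f xs) c)) (code-map H xs φ)
    ; map-comp = comp-tagged 7 (comp-pair (comp-∘ f-comp comp-tail) (map-comp H)) }

  compT-∃ : ∀ {k} {f : Vec ℕ k → ℕ} {H : Vec ℕ k → Formula → Formula} → Comp f → CompT H →
    CompT (λ xs φ → ∃' (f xs) (H xs φ))
  compT-∃ {f = f} f-comp H = record
    { codeMap  = λ xs c → pair 8 (pair (f xs) (codeMap H xs c))
    ; code-map = λ xs φ → cong (λ c → pair 8 (pair (f xs) c)) (code-map H xs φ)
    ; map-comp = comp-tagged 8 (comp-pair (comp-∘ f-comp comp-tail) (map-comp H)) }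

  compF-rec : ∀ {k} {F : Vec ℕ (suc k) → Formula} {G : Vec ℕ k → Formula}
    {H : Vec ℕ (suc k) → Formula → Formula} →
    (∀ xs → F (0 ∷ xs) ≡ G xs) → (∀ n xs → F (suc n ∷ xs) ≡ H (n ∷ xs) (F (n ∷ xs))) →
    CompF G → CompT H → CompF F
  compF-rec {F = F} F0 Fs (coded G) H = coded (comp-rec
    {h = λ v → codeMap H (lookupV v #0 ∷ Vec.tail (Vec.tail v)) (lookupV v #1)}
    (λ xs → cong code (F0 xs))
    (λ n xs → trans (cong code (Fs n xs)) (code-map H (n ∷ xs) (F (n ∷ xs))))
    G (comp-∘ (map-comp H) (comp-lookup #1 ∷ᶜ comp-lookup #0 ∷ᶜ comp-tail²)))

  compF-eqF : ∀ R → CompF {2} (λ v → eqF R (lookupV v #0) (lookupV v #1))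
  compF-eqF R = compF-rec (λ { (_ ∷ []) → refl }) (λ { _ (_ ∷ []) → refl })
    (compF-∘ compF-atomsF (comp-lookup #0 ∷ᶜ []ᶜ))
    (compT-∧ (compT-∀ x (compT-∃ y compT-id)) (compT-∀ y (compT-∃ x compT-id)))
    where
    x : Comp {2} (λ v → R + lookupV v #0)
    x = comp-+ (comp-const R) (comp-lookup #0)
    y : Comp {2} (λ v → lookupV v #1 + (R + lookupV v #0))
    y = comp-+ (comp-lookup #1) x

  module _ {R m} (S : Vec (Idx (Fin (suc m))) R) where

    comp-top : ∀ {k} → Comp {suc k} (top S)
    comp-top {k} = comp-+ (comp-const R) (comp-lookup (lastPos k))

    comp-arrayVar : ∀ {k} e → Comp {suc k} (λ ctx → arrayVar S ctx e)
    comp-arrayVar (j , l) =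
      comp-+ comp-top (comp-+ comp-top (comp-pair (comp-const j) (comp-codeList l)))
      where
      comp-codeList : ∀ {k} (l : List (Fin k)) → Comp (λ ctx → codeList (List.map (lookupV ctx) l))
      comp-codeList []      = comp-const 0
      comp-codeList (i ∷ l) = comp-suc (comp-pair (comp-lookup i) (comp-codeList l))

    compF-bodyF : CompF (bodyF S)
    compF-bodyF = compF-∧
      (compF-loop firstPos 2 {distinctF S} (compF-¬
        (compF-≐ (comp-var (comp-arrayVar (0 , #0 ∷ []))) (comp-var (comp-arrayVar (0 , #1 ∷ []))))))
      (compF-loop firstPos m {matchF S} (compF-block∃ comp-top (comp-const R) (compF-∧
        (compF-andFin R λ i → compF-≐
          (comp-var (comp-+ comp-top (comp-const (toℕ i)))) (comp-var (comp-arrayVar (Vec.lookup S i))))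
        (compF-∘ (compF-eqF R) (comp-lookup (lastPos m) ∷ᶜ comp-top ∷ᶜ []ᶜ)))))

  compF-close∃ : ∀ {k} b {f : Vec ℕ k → ℕ} {F : Vec ℕ k → Formula} → Comp f → CompF F →
    CompF (λ xs → close∃ b (f xs) (F xs))
  compF-close∃ b f F = compF-block∃ (comp-const b) (comp-suc (comp-+ f (code-comp F))) F

  formulas-recursive : (F : ℕ → Formula) → (∀ N → N ≤ code (F N)) →
    CompF {1} (λ v → F (lookupV v #0)) →
    RecursiveSet (λ c → Σ Formula λ φ → (Σ ℕ λ N → φ ≡ F N) × code φ ≡ c)
  formulas-recursive F N≤ F-comp with range-recursive (λ N → code (F N)) N≤ (code-comp F-comp)
  ... | e , decide = e , λ c →
    [ (λ { ((N , eq) , ev) → inj₁ ((F N , (N , refl) , eq) , ev) }) ,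
      (λ { (none , ev) → inj₂ ((λ { (_ , (N , refl) , eq) → none (N , eq) }) , ev) }) ]′ (decide c)

  closures-recursive : ∀ b (F : ℕ → Formula) → CompF {1} (λ v → F (lookupV v #0)) →
    RecursiveSet (λ c → Σ Formula λ φ → (Σ ℕ λ N → φ ≡ close∃ b N (F N)) × code φ ≡ c)
  closures-recursive b F F-comp = formulas-recursive (λ N → close∃ b N (F N))
    (λ N → N≤code-close∃ b N (F N)) (compF-close∃ b (comp-lookup #0) F-comp)

-- Semantics of the formulas

-- Decoding serves only to define assignments, arrays and enumerations, never inside a formula, so a
-- classical left inverse suffices and no computable one is constructed.
retraction : ExcludedMiddle 0ℓ → {X Y : Set} → X → (f : X → Y) → (∀ {x x′} → f x ≡ f x′ → x ≡ x′) →
  Σ (Y → X) λ g → ∀ x → g (f x) ≡ x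
retraction em {X} {Y} x₀ f inj = (λ y → choose y em) , λ x → chosen x em
  where
  choose : ∀ y → Dec (Σ X λ x → f x ≡ y) → X
  choose y (yes (x , _)) = x
  choose y (no _)        = x₀
  chosen : ∀ x (d : Dec (Σ X λ x′ → f x′ ≡ f x)) → choose (f x) d ≡ x
  chosen x (yes (x′ , eq)) = inj eq
  chosen x (no none)       = ⊥-elim (none (x , refl))

-- Free variables bounded by codes.

module _ (L : Language) where
  open Syntax L
  open TypeFormulas L

  mutual
    occT≤codeT : ∀ {j} t → OccT j t → j ≤ codeT t
    occT≤codeT (var i)    refl = n≤pair 0 i
    occT≤codeT (app f ts) o    = ≤-trans (occTs≤codeTs ts o) (≤-trans (n≤pair (toℕ f) _) (n≤pair 1 _))

    occTs≤codeTs : ∀ {n j} (ts : Vec Term n) → OccTs j ts → j ≤ codeTs ts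
    occTs≤codeTs (t ∷ ts) (inj₁ o) = m≤n⇒m≤1+n (≤-trans (occT≤codeT t o) (m≤pair _ _))
    occTs≤codeTs (t ∷ ts) (inj₂ o) = m≤n⇒m≤1+n (≤-trans (occTs≤codeTs ts o) (n≤pair (codeT t) _))

  -- A crude bound on the variables, which makes the length of a closing block computable from the
  -- code.
  free≤code : ∀ {j} φ → Free j φ → j ≤ code φ
  free≤code (s ≐ t) (inj₁ o)    = ≤-trans (occT≤codeT s o) (≤-trans (m≤pair _ _) (n≤pair 1 _))
  free≤code (s ≐ t) (inj₂ o)    = ≤-trans (occT≤codeT t o) (≤-trans (n≤pair (codeT s) _) (n≤pair 1 _))
  free≤code (rel r ts) o        = ≤-trans (occTs≤codeTs ts o) (≤-trans (n≤pair (toℕ r) _) (n≤pair 2 _))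
  free≤code (¬' φ) o            = ≤-trans (free≤code φ o) (n≤pair 3 _)
  free≤code (φ ∧' ψ) (inj₁ o)   = ≤-trans (free≤code φ o) (≤-trans (m≤pair _ _) (n≤pair 4 _))
  free≤code (φ ∧' ψ) (inj₂ o)   = ≤-trans (free≤code ψ o) (≤-trans (n≤pair (code φ) _) (n≤pair 4 _))
  free≤code (φ ∨' ψ) (inj₁ o)   = ≤-trans (free≤code φ o) (≤-trans (m≤pair _ _) (n≤pair 5 _))
  free≤code (φ ∨' ψ) (inj₂ o)   = ≤-trans (free≤code ψ o) (≤-trans (n≤pair (code φ) _) (n≤pair 5 _))
  free≤code (φ ⇒' ψ) (inj₁ o)   = ≤-trans (free≤code φ o) (≤-trans (m≤pair _ _) (n≤pair 6 _))
  free≤code (φ ⇒' ψ) (inj₂ o)   = ≤-trans (free≤code ψ o) (≤-trans (n≤pair (code φ) _) (n≤pair 6 _))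
  free≤code (∀' i φ) (_ , o)    = ≤-trans (free≤code φ o) (≤-trans (n≤pair i _) (n≤pair 7 _))
  free≤code (∃' i φ) (_ , o)    = ≤-trans (free≤code φ o) (≤-trans (n≤pair i _) (n≤pair 8 _))

  free-block∃ : ∀ {j} b n φ → Free j (block∃ b n φ) → Free j φ × (j < b ⊎ b + n ≤ j)
  free-block∃ {j} b zero φ o =
    o , [ inj₁ , (λ b≤j → inj₂ (subst (_≤ j) (sym (+-identityʳ b)) b≤j)) ]′ (<-≤-connex j b)
  free-block∃ {j} b (suc n) φ (j≢ , o) with free-block∃ b n φ o
  ... | o′ , inj₁ j<b = o′ , inj₁ j<b
  ... | o′ , inj₂ b+n≤j =
    o′ , inj₂ (subst (_≤ j) (sym (+-suc b n)) (≤∧≢⇒< b+n≤j (j≢ ∘ sym)))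

  free-close∃ : ∀ b N φ → FreeVarsBelow b (close∃ b N φ)
  free-close∃ b N φ j o with free-block∃ b (suc (N + code φ)) φ o
  ... | _  , inj₁ j<b = j<b
  ... | o′ , inj₂ ≤j  = ⊥-elim (<⇒≱ (≤-trans (s≤s (≤-trans (free≤code φ o′) (m≤n+m (code φ) N)))
                                             (m≤n+m _ b)) ≤j)

module TypeSemantics {L : Language} (𝔄 : Structure L) where
  open Language L
  open Syntax L
  open Semantics 𝔄
  open Structure 𝔄 renaming (Carrier to A)
  open TypeFormulas L
  open Game 𝔄

  update-same : ∀ ρ i a → (ρ [ i ↦ a ]) i ≡ a
  update-same ρ i a with i ≡ᵇ i | ≡⇒≡ᵇ i i refl
  ... | true | _ = refl

  update-other : ∀ ρ {i j} a → j ≢ i → (ρ [ i ↦ a ]) j ≡ ρ j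
  update-other ρ {i} {j} a j≢i with j ≡ᵇ i | ≡ᵇ⇒≡ j i
  ... | true  | j≡i = ⊥-elim (j≢i (j≡i tt))
  ... | false | _   = refl

  update-cong : ∀ {ρ ρ′} i a {P : ℕ → Set} → (∀ j → j ≢ i × P j → ρ j ≡ ρ′ j) →
    ∀ j → P j → (ρ [ i ↦ a ]) j ≡ (ρ′ [ i ↦ a ]) j
  update-cong i a eq j Pj with j ≡ᵇ i | ≡⇒≡ᵇ j i
  ... | true  | _   = refl
  ... | false | j≢i = eq j (j≢i , Pj)

  mutual
    evalT-cong : ∀ {ρ ρ′} t → (∀ j → OccT j t → ρ j ≡ ρ′ j) → evalT ρ t ≡ evalT ρ′ t
    evalT-cong (var i)    eq = eq i refl
    evalT-cong (app f ts) eq = cong (funI f) (evalTs-cong ts eq)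

    evalTs-cong : ∀ {ρ ρ′ n} (ts : Vec Term n) → (∀ j → OccTs j ts → ρ j ≡ ρ′ j) →
      evalTs ρ ts ≡ evalTs ρ′ ts
    evalTs-cong []       eq = refl
    evalTs-cong (t ∷ ts) eq =
      cong₂ _∷_ (evalT-cong t (λ j → eq j ∘ inj₁)) (evalTs-cong ts (λ j → eq j ∘ inj₂))

  Sat-cong : ∀ {ρ ρ′} φ → (∀ j → Free j φ → ρ j ≡ ρ′ j) → Sat ρ φ → Sat ρ′ φ
  Sat-cong (s ≐ t) eq h =
    trans (sym (evalT-cong s (λ j → eq j ∘ inj₁))) (trans h (evalT-cong t (λ j → eq j ∘ inj₂)))
  Sat-cong (rel r ts) eq h = subst (relI r) (evalTs-cong ts eq) h
  Sat-cong (¬' φ) eq h h′ = h (Sat-cong φ (λ j → sym ∘ eq j) h′)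
  Sat-cong (φ ∧' ψ) eq (h , h′) = Sat-cong φ (λ j → eq j ∘ inj₁) h , Sat-cong ψ (λ j → eq j ∘ inj₂) h′
  Sat-cong (φ ∨' ψ) eq (inj₁ h) = inj₁ (Sat-cong φ (λ j → eq j ∘ inj₁) h)
  Sat-cong (φ ∨' ψ) eq (inj₂ h) = inj₂ (Sat-cong ψ (λ j → eq j ∘ inj₂) h)
  Sat-cong (φ ⇒' ψ) eq h h′ =
    Sat-cong ψ (λ j → eq j ∘ inj₂) (h (Sat-cong φ (λ j → sym ∘ eq j ∘ inj₁) h′))
  Sat-cong (∀' i φ) eq h a = Sat-cong φ (update-cong i a eq) (h a)
  Sat-cong (∃' i φ) eq (a , h) = a , Sat-cong φ (update-cong i a eq) h

  bigAnd⇔ : ∀ {ρ F} n → Sat ρ (bigAnd n F) ⇔ (∀ x → x < n → Sat ρ (F x))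
  bigAnd⇔ {ρ} {F} n = mk⇔ (elim n) (intro n)
    where
    elim : ∀ n → Sat ρ (bigAnd n F) → ∀ x → x < n → Sat ρ (F x)
    elim (suc n) (h , hs) x x< with x ≟ n
    ... | yes refl = h
    ... | no x≢n   = elim n hs x (≤∧≢⇒< (s≤s⁻¹ x<) x≢n)
    intro : ∀ n → (∀ x → x < n → Sat ρ (F x)) → Sat ρ (bigAnd n F)
    intro zero    hs = id
    intro (suc n) hs = hs n ≤-refl , intro n (λ x x< → hs x (m≤n⇒m≤1+n x<))

  andFin⇔ : ∀ {ρ} n {F} → Sat ρ (andFin n F) ⇔ (∀ i → Sat ρ (F i))
  andFin⇔ {ρ} n = mk⇔ (elim n) (intro n)
    where
    elim : ∀ n {F} → Sat ρ (andFin n F) → ∀ i → Sat ρ (F i)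
    elim (suc n) (h , hs) zero    = h
    elim (suc n) (h , hs) (suc i) = elim n hs i
    intro : ∀ n {F} → (∀ i → Sat ρ (F i)) → Sat ρ (andFin n F)
    intro zero    hs = id
    intro (suc n) hs = hs zero , intro n (hs ∘ suc)

  block∃-elim : ∀ {ρ} b n φ → Sat ρ (block∃ b n φ) →
    Σ Assignment λ ρ′ → (∀ j → j < b ⊎ b + n ≤ j → ρ′ j ≡ ρ j) × Sat ρ′ φ
  block∃-elim {ρ} b zero φ h = ρ , (λ _ _ → refl) , h
  block∃-elim {ρ} b (suc n) φ (a , h) with block∃-elim b n φ h
  ... | ρ′ , eq , h′ = ρ′ , eq′ , h′
    where
    eq′ : ∀ j → j < b ⊎ b + suc n ≤ j → ρ′ j ≡ ρ j
    eq′ j (inj₁ j<b) =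
      trans (eq j (inj₁ j<b)) (update-other ρ a (<⇒≢ (≤-trans j<b (m≤m+n b n))))
    eq′ j (inj₂ ≤j) with subst (_≤ j) (+-suc b n) ≤j
    ... | <j = trans (eq j (inj₂ (<⇒≤ <j))) (update-other ρ a (>⇒≢ <j))

  block∃-intro : ∀ {ρ} b n φ {ρ′} → (∀ j → j < b ⊎ b + n ≤ j → ρ′ j ≡ ρ j) → Sat ρ′ φ →
    Sat ρ (block∃ b n φ)
  block∃-intro {ρ} b zero φ eq h = Sat-cong φ
    (λ j _ → eq j ([ inj₁ , inj₂ ∘ subst (_≤ j) (sym (+-identityʳ b)) ]′ (<-≤-connex j b))) h
  block∃-intro {ρ} b (suc n) φ {ρ′} eq h = ρ′ (b + n) , block∃-intro b n φ eq′ h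
    where
    eq′ : ∀ j → j < b ⊎ b + n ≤ j → ρ′ j ≡ (ρ [ b + n ↦ ρ′ (b + n) ]) j
    eq′ j c with j ≟ b + n
    ... | yes refl = sym (update-same ρ (b + n) _)
    eq′ j (inj₁ j<b) | no j≢ = trans (eq j (inj₁ j<b)) (sym (update-other ρ _ j≢))
    eq′ j (inj₂ ≤j)  | no j≢ = trans
      (eq j (inj₂ (subst (_≤ j) (sym (+-suc b n)) (≤∧≢⇒< ≤j (j≢ ∘ sym))))) (sym (update-other ρ _ j≢))

  close∃-elim : ∀ {ρ} b N φ → Sat ρ (close∃ b N φ) →
    Σ Assignment λ ρ′ → (∀ j → j < b → ρ′ j ≡ ρ j) × Sat ρ′ φ
  close∃-elim b N φ h with block∃-elim b (suc (N + code φ)) φ h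
  ... | ρ′ , eq , h′ = ρ′ , (λ j → eq j ∘ inj₁) , h′

  close∃-intro : ∀ {ρ} b N φ {ρ′} → (∀ j → j < b → ρ′ j ≡ ρ j) → Sat ρ′ φ → Sat ρ (close∃ b N φ)
  close∃-intro {ρ} b N φ {ρ′} eq h = block∃-intro b len φ agrees (Sat-cong φ within h)
    where
    len = suc (N + code φ)
    -- `ρ′` may differ from `ρ` beyond the block; no variable there is free in `φ`, so the values of
    -- `ρ` can be restored.
    ρ″ : Assignment
    ρ″ j with j <? b + len
    ... | yes _ = ρ′ j
    ... | no  _ = ρ j
    within : ∀ j → Free j φ → ρ′ j ≡ ρ″ j
    within j o with j <? b + len
    ... | yes _ = refl
    ... | no j≮ = ⊥-elim (j≮ (≤-trans (s≤s (≤-trans (free≤code L φ o) (m≤n+m _ N))) (m≤n+m len b)))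
    agrees : ∀ j → j < b ⊎ b + len ≤ j → ρ″ j ≡ ρ j
    agrees j out with j <? b + len
    agrees j out        | no _   = refl
    agrees j (inj₁ j<b) | yes _  = eq j j<b
    agrees j (inj₂ ≤j)  | yes j< = ⊥-elim (<⇒≱ j< ≤j)

  -- The contexts over which `loop s` takes its conjunction when started at `N`.
  data Chain (s : ∀ m → Fin (suc m)) (N : ℕ) : ∀ {m} → Vec ℕ (suc m) → Set where
    base : Chain s N (N ∷ [])
    _∷_  : ∀ {m x} {ctx : Vec ℕ (suc m)} → x < lookupV ctx (s m) → Chain s N ctx → Chain s N (x ∷ ctx)

  chain-end : ∀ {s N m} {ctx : Vec ℕ (suc m)} → Chain s N ctx → end ctx ≡ N
  chain-end base    = refl
  chain-end (_ ∷ c) = chain-end c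

  loop⇔ : ∀ {ρ} s m F N → Sat ρ (loop s m F (N ∷ [])) ⇔ (∀ ctx → Chain s N ctx → Sat ρ (F ctx))
  loop⇔ s zero F N = mk⇔ (λ { h _ base → h }) (λ h → h (N ∷ []) base)
  loop⇔ {ρ} s (suc m) F N = mk⇔
    (λ { h (x ∷ ctx) (x< ∷ c) → to (bigAnd⇔ _) (to (loop⇔ s m F′ N) h ctx c) x x< })
    (λ h → from (loop⇔ s m F′ N) λ ctx c →
      from (bigAnd⇔ {F = λ x → F (x ∷ ctx)} _) λ x x< → h (x ∷ ctx) (x< ∷ c))
    where
    F′ : Vec ℕ (suc m) → Formula
    F′ ctx = bigAnd (lookupV ctx (s m)) (λ x → F (x ∷ ctx))

  evalTs-vars : ∀ ρ s {m} (is : Vec ℕ m) → evalTs ρ (vars s is) ≡ Vec.map (λ i → ρ (s + i)) is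
  evalTs-vars ρ s []       = refl
  evalTs-vars ρ s (i ∷ is) = cong (ρ (s + i) ∷_) (evalTs-vars ρ s is)

  atomFormula⇔ : ∀ ρ s t → Sat ρ (atomFormula s t) ⇔ Holds (mapA (λ i → ρ (s + i)) t)
  atomFormula⇔ ρ s (eqA i j) = mk⇔ id id
  atomFormula⇔ ρ s (funA f is i) = mk⇔
    (trans (cong (funI f) (sym (evalTs-vars ρ s is)))) (trans (cong (funI f) (evalTs-vars ρ s is)))
  atomFormula⇔ ρ s (relA r is) = mk⇔
    (subst (relI r) (evalTs-vars ρ s is)) (subst (relI r) (sym (evalTs-vars ρ s is)))

  agree⇔ : ∀ ρ T t → Sat ρ (agree T t) ⇔ (Holds (mapA ρ t) ⇔ Holds (mapA (λ i → ρ (T + i)) t))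
  agree⇔ ρ T t = mk⇔
    (λ { (h , h′) → mk⇔ (to shifted ∘ h ∘ from plain) (to plain ∘ h′ ∘ from shifted) })
    (λ e → from shifted ∘ to e ∘ to plain , from plain ∘ from e ∘ to shifted)
    where
    plain : Sat ρ (atomFormula 0 t) ⇔ Holds (mapA ρ t)
    plain = atomFormula⇔ ρ 0 t
    shifted : Sat ρ (atomFormula T t) ⇔ Holds (mapA (λ i → ρ (T + i)) t)
    shifted = atomFormula⇔ ρ T t

  Below : ℕ → Set
  Below T = Σ ℕ (_< T)

  chain-snoc : ∀ {T m} (v : Vec (Below T) m) → Chain lastPos T (Vec.map proj₁ v Vec.∷ʳ T)
  chain-snoc [] = base
  chain-snoc {T} ((x , x<) ∷ v) = subst (x <_) (sym (chain-end (chain-snoc v))) x< ∷ chain-snoc v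

  initial-snoc : ∀ {m} (v : Vec ℕ m) T → initial (v Vec.∷ʳ T) ≡ v
  initial-snoc []          T = refl
  initial-snoc (x ∷ [])    T = refl
  initial-snoc (x ∷ y ∷ v) T = cong (x ∷_) (initial-snoc (y ∷ v) T)

  chain-initial : ∀ {T m} {ctx : Vec ℕ (suc m)} → Chain lastPos T ctx →
    Σ (Vec (Below T) m) λ v → initial ctx ≡ Vec.map proj₁ v
  chain-initial base = [] , refl
  chain-initial {ctx = x ∷ y ∷ ys} (x< ∷ c) with chain-initial c
  ... | v , eq = (x , subst (x <_) (chain-end c) x<) ∷ v , cong (x ∷_) eq

  atomsF⇔ : ∀ ρ T → Sat ρ (atomsF (T ∷ [])) ⇔ Eqv 0 {Below T} (ρ ∘ proj₁) (λ i → ρ (T + proj₁ i))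
  atomsF⇔ ρ T = mk⇔ elim intro
    where
    lower : ∀ {T′} → T′ ≡ T → ∀ (t : Atom L (Below T)) {t′} → t′ ≡ mapA proj₁ t →
      Sat ρ (agree T′ t′) ⇔ (Holds (mapA (ρ ∘ proj₁) t) ⇔ Holds (mapA (λ i → ρ (T + proj₁ i)) t))
    lower refl t refl = subst₂ (λ x y → Sat ρ (agree T (mapA proj₁ t)) ⇔ (Holds x ⇔ Holds y))
      (sym (mapA-∘ ρ proj₁ (λ _ → refl) t)) (sym (mapA-∘ (λ i → ρ (T + i)) proj₁ (λ _ → refl) t))
      (agree⇔ ρ T (mapA proj₁ t))
    elim : Sat ρ (atomsF (T ∷ [])) → Eqv 0 {Below T} (ρ ∘ proj₁) (λ i → ρ (T + proj₁ i))
    elim (h , _ , _) t@(eqA (i , i<) (j , j<)) =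
      to (lower refl t refl) (to (loop⇔ lastPos 2 eqAtom T) h (i ∷ j ∷ T ∷ []) (i< ∷ (j< ∷ base)))
    elim (_ , h , _) t@(funA f is (i , i<)) =
      to (lower (chain-end c) t (cong (λ v → funA f v i) (initial-snoc (Vec.map proj₁ is) T)))
        (to (loop⇔ lastPos (suc (funAr f)) (funAtom f) T) (to (andFin⇔ nFun) h f)
          (i ∷ (Vec.map proj₁ is Vec.∷ʳ T)) (subst (i <_) (sym (chain-end c)) i< ∷ c))
      where
      c = chain-snoc is
    elim (_ , _ , h) t@(relA r is) =
      to (lower (chain-end (chain-snoc is)) t (cong (relA r) (initial-snoc (Vec.map proj₁ is) T)))
        (to (loop⇔ lastPos (relAr r) (relAtom r) T) (to (andFin⇔ nRel) h r)
          (Vec.map proj₁ is Vec.∷ʳ T) (chain-snoc is))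
    intro : Eqv 0 {Below T} (ρ ∘ proj₁) (λ i → ρ (T + proj₁ i)) → Sat ρ (atomsF (T ∷ []))
    intro e =
      from (loop⇔ lastPos 2 eqAtom T) (λ { (i ∷ j ∷ T ∷ []) (i< ∷ (j< ∷ base)) →
        from (lower refl (eqA (i , i<) (j , j<)) refl) (e (eqA (i , i<) (j , j<))) }) ,
      from (andFin⇔ nFun) (λ f → from (loop⇔ lastPos (suc (funAr f)) (funAtom f) T)
        λ { (i ∷ ctx) (i< ∷ c) → let v , eq = chain-initial c
                                     t = funA f v (i , subst (i <_) (chain-end c) i<)
          in from (lower (chain-end c) t (cong (λ v → funA f v i) eq)) (e t) }) ,
      from (andFin⇔ nRel) (λ r → from (loop⇔ lastPos (relAr r) (relAtom r) T)
        λ ctx c → let v , eq = chain-initial c ; t = relA r v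
          in from (lower (chain-end c) t (cong (relA r) eq)) (e t))

-- Semantics of the game formula, and the realization of array types.

module ArrayTypes {L : Language} (𝔄 : Structure L) where
  open Language L
  open Syntax L
  open Semantics 𝔄
  open Structure 𝔄 renaming (Carrier to A)
  open TypeFormulas L
  open Game 𝔄
  open TypeSemantics 𝔄

  -- `ι` gives the variable of each position in play. The last two hypotheses say that every
  -- variable below `T` belongs to a position or is reserved for a coming move, and never both.
  -- After the last round the positions exhaust the variables below `T`, which are what `atomsF`
  -- tests.
  eqF⇔ : ∀ n R T ρ {I : Set} (ι : I → ℕ) → (∀ i → ι i < T) → R + n ≤ T →
    (∀ i k → k < n → ι i ≢ R + k) →
    (∀ k → k < T → Σ I (λ i → ι i ≡ k) ⊎ Σ ℕ (λ k′ → k′ < n × k ≡ R + k′)) →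
    Sat ρ (eqF R n T) ⇔ Eqv n (ρ ∘ ι) (λ i → ρ (T + ι i))
  eqF⇔ zero R T ρ {I} ι ι<T _ _ cover = mk⇔
    (λ h → eqv-reindex 0 (λ i → ι i , ι<T i) (λ _ → refl) (λ _ → refl) (to (atomsF⇔ ρ T) h))
    (λ e → from (atomsF⇔ ρ T) (eqv-reindex 0 (proj₁ ∘ index)
      (λ b → cong ρ (sym (proj₂ (index b)))) (λ b → cong (λ k → ρ (T + k)) (sym (proj₂ (index b)))) e))
    where
    index : (b : Below T) → Σ I λ i → ι i ≡ proj₁ b
    index (k , k<) with cover k k<
    ... | inj₁ i            = i
    ... | inj₂ (_ , () , _)
  eqF⇔ (suc n) R T ρ {I} ι ι<T ≤T fresh cover = mk⇔
    (λ { (forth , back) →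
      (λ c → let d , h = forth c in d , to (round₁ c d) h) ,
      (λ d → let c , h = back d in c , to (round₂ c d) h) })
    (λ { (forth , back) →
      (λ c → let d , e = forth c in d , from (round₁ c d) e) ,
      (λ d → let c , e = back d in c , from (round₂ c d) e) })
    where
    x y : ℕ
    x = R + n
    y = T + (R + n)
    x<T : x < T
    x<T = subst (_≤ T) (+-suc R n) ≤T
    x≢y : x ≢ y
    x≢y = <⇒≢ (≤-trans x<T (m≤m+n T x))
    ι⁺ : Maybe I → ℕ
    ι⁺ (just i) = ι i
    ι⁺ nothing  = x
    ι⁺<T : ∀ i → ι⁺ i < T
    ι⁺<T (just i) = ι<T i
    ι⁺<T nothing  = x<T
    fresh⁺ : ∀ i k → k < n → ι⁺ i ≢ R + k
    fresh⁺ (just i) k k<n eq = fresh i k (m≤n⇒m≤1+n k<n) eq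
    fresh⁺ nothing  k k<n eq = >⇒≢ k<n (+-cancelˡ-≡ R n k eq)
    cover⁺ : ∀ k → k < T → Σ (Maybe I) (λ i → ι⁺ i ≡ k) ⊎ Σ ℕ (λ k′ → k′ < n × k ≡ R + k′)
    cover⁺ k k<T with cover k k<T
    ... | inj₁ (i , eq) = inj₁ (just i , eq)
    ... | inj₂ (k′ , k′< , eq) with k′ ≟ n
    ...   | yes refl = inj₁ (nothing , sym eq)
    ...   | no k′≢n  = inj₂ (k′ , ≤∧≢⇒< (s≤s⁻¹ k′<) k′≢n , eq)
    -- The two halves of a round assign `x` and `y` in opposite orders; only the resulting values
    -- matter.
    module _ (c d : A) (ρ′ : Assignment) (at-x : ρ′ x ≡ c) (at-y : ρ′ y ≡ d)
             (else : ∀ {j} → j ≢ x → j ≢ y → ρ′ j ≡ ρ j) where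
      left : ρ′ ∘ ι⁺ ≗ ext c (ρ ∘ ι)
      left nothing  = at-x
      left (just i) = else (fresh i n ≤-refl) (<⇒≢ (≤-trans (ι<T i) (m≤m+n T x)))
      right : (λ i → ρ′ (T + ι⁺ i)) ≗ ext d (λ i → ρ (T + ι i))
      right nothing  = at-y
      right (just i) = else (>⇒≢ (≤-trans x<T (m≤m+n T (ι i))))
                            (fresh i n ≤-refl ∘ +-cancelˡ-≡ T (ι i) x)
      round : Sat ρ′ (eqF R n T) ⇔ Eqv n (ext c (ρ ∘ ι)) (ext d (λ i → ρ (T + ι i)))
      round = mk⇔
        (λ h → eqv-reindex n id (sym ∘ left) (sym ∘ right) (to IH h))
        (λ e → from IH (eqv-reindex n id left right e))
        where
        IH : Sat ρ′ (eqF R n T) ⇔ Eqv n (ρ′ ∘ ι⁺) (λ i → ρ′ (T + ι⁺ i))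
        IH = eqF⇔ n R T ρ′ ι⁺ ι⁺<T (<⇒≤ x<T) fresh⁺ cover⁺
    round₁ : ∀ c d → Sat ((ρ [ x ↦ c ]) [ y ↦ d ]) (eqF R n T) ⇔
      Eqv n (ext c (ρ ∘ ι)) (ext d (λ i → ρ (T + ι i)))
    round₁ c d = round c d ((ρ [ x ↦ c ]) [ y ↦ d ])
      (trans (update-other (ρ [ x ↦ c ]) d x≢y) (update-same ρ x c)) (update-same (ρ [ x ↦ c ]) y d)
      (λ j≢x j≢y → trans (update-other (ρ [ x ↦ c ]) d j≢y) (update-other ρ c j≢x))
    round₂ : ∀ c d → Sat ((ρ [ y ↦ d ]) [ x ↦ c ]) (eqF R n T) ⇔
      Eqv n (ext c (ρ ∘ ι)) (ext d (λ i → ρ (T + ι i)))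
    round₂ c d = round c d ((ρ [ y ↦ d ]) [ x ↦ c ])
      (update-same (ρ [ y ↦ d ]) x c) (trans (update-other (ρ [ y ↦ d ]) c (x≢y ∘ sym)) (update-same ρ y d))
      (λ j≢x j≢y → trans (update-other (ρ [ y ↦ d ]) c j≢x) (update-other ρ d j≢y))

  patch : ∀ b {n} → (Fin n → A) → Assignment → Assignment
  patch b {n} f ρ j with b ≤? j | j ∸ b <? n
  ... | yes _ | yes j< = f (fromℕ< j<)
  ... | _     | _      = ρ j

  patch-in : ∀ b {n} (f : Fin n → A) ρ i → patch b f ρ (b + toℕ i) ≡ f i
  patch-in b {n} f ρ i with b ≤? b + toℕ i | b + toℕ i ∸ b <? n
  ... | yes _ | yes j< = cong f (trans (fromℕ<-cong _ _ (m+n∸m≡n b (toℕ i)) j< (toℕ<n i))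
                                       (fromℕ<-toℕ i (toℕ<n i)))
  ... | no b≰ | _      = ⊥-elim (b≰ (m≤m+n b (toℕ i)))
  ... | yes _ | no j≮  = ⊥-elim (j≮ (subst (_< n) (sym (m+n∸m≡n b (toℕ i))) (toℕ<n i)))

  patch-out : ∀ b {n} (f : Fin n → A) ρ j → j < b ⊎ b + n ≤ j → patch b f ρ j ≡ ρ j
  patch-out b {n} f ρ j out with b ≤? j | j ∸ b <? n
  ... | no _    | _      = refl
  ... | yes _   | no _   = refl
  patch-out b {n} f ρ j (inj₁ j<b)   | yes b≤j | yes _  = ⊥-elim (<⇒≱ j<b b≤j)
  patch-out b {n} f ρ j (inj₂ b+n≤j) | yes b≤j | yes j< =
    ⊥-elim (<⇒≱ j< (subst (_≤ j ∸ b) (m+n∸m≡n b n) (∸-monoˡ-≤ b b+n≤j)))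

  Distinct : (Idx ℕ → A) → ℕ → Set
  Distinct z N = ∀ x y → y < x → x < N → z (0 , x ∷ []) ≢ z (0 , y ∷ [])

  -- `N` is at once the number of points and the number of rounds, so that the demands form a single
  -- sequence.
  ArrayAt : ∀ {R m} → Vec (Idx (Fin (suc m))) R → (Fin R → A) → ℕ → Set
  ArrayAt {R} {m} S a N = Σ (Idx ℕ → A) λ z → Distinct z N ×
    (∀ (ctx : Vec ℕ (suc m)) → Chain firstPos N ctx →
      Eqv N a (λ i → z (mapIdx (lookupV ctx) (Vec.lookup S i))))

  module _ {R m} (S : Vec (Idx (Fin (suc m))) R) where

    matchF⇔ : ∀ ρ (ctx : Vec ℕ (suc m)) → Sat ρ (matchF S ctx) ⇔
      Eqv (end ctx) {Fin R} (ρ ∘ toℕ) (λ i → ρ (arrayVar S ctx (Vec.lookup S i)))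
    matchF⇔ ρ ctx = mk⇔ elim intro
      where
      T = top S ctx
      target : Fin R → A
      target i = ρ (arrayVar S ctx (Vec.lookup S i))
      equations : Fin R → Formula
      equations i = var (T + toℕ i) ≐ var (arrayVar S ctx (Vec.lookup S i))
      R≤T : R ≤ T
      R≤T = m≤m+n R (end ctx)
      below : ∀ (i : Fin R) → toℕ i < T
      below i = ≤-trans (toℕ<n i) R≤T
      beyond : ∀ i → T + R ≤ arrayVar S ctx (Vec.lookup S i)
      beyond i = +-monoʳ-≤ T (≤-trans R≤T (m≤m+n T _))
      game : ∀ ρ′ → Sat ρ′ (eqF R (end ctx) T) ⇔ Eqv (end ctx) (ρ′ ∘ toℕ) (λ i → ρ′ (T + toℕ i))
      game ρ′ = eqF⇔ (end ctx) R T ρ′ toℕ below ≤-refl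
        (λ i k _ → <⇒≢ (≤-trans (toℕ<n i) (m≤m+n R k)))
        λ k k<T → [ (λ k<R → inj₁ (fromℕ< k<R , toℕ-fromℕ< k<R)) ,
                    (λ R≤k → inj₂ (k ∸ R ,
                      +-cancelˡ-< R (k ∸ R) (end ctx) (subst (_< T) (sym (m+[n∸m]≡n R≤k)) k<T) ,
                      sym (m+[n∸m]≡n R≤k))) ]′ (<-≤-connex k R)
      elim : Sat ρ (matchF S ctx) → Eqv (end ctx) {Fin R} (ρ ∘ toℕ) target
      elim h with block∃-elim T R (andFin R equations ∧' eqF R (end ctx) T) h
      ... | ρ′ , eq , (eqs , g) = eqv-reindex (end ctx) id
        (λ i → sym (eq (toℕ i) (inj₁ (below i))))
        (λ i → trans (sym (eq _ (inj₂ (beyond i)))) (sym (to (andFin⇔ R {equations}) eqs i)))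
        (to (game ρ′) g)
      intro : Eqv (end ctx) {Fin R} (ρ ∘ toℕ) target → Sat ρ (matchF S ctx)
      intro e = block∃-intro T R (andFin R equations ∧' eqF R (end ctx) T) out
        (from (andFin⇔ R {equations}) (λ i → trans (patch-in T target ρ i) (sym (out _ (inj₂ (beyond i))))) ,
         from (game (patch T target ρ)) (eqv-reindex (end ctx) id
           (λ i → out (toℕ i) (inj₁ (below i))) (λ i → patch-in T target ρ i) e))
        where
        out : ∀ j → j < T ⊎ T + R ≤ j → patch T target ρ j ≡ ρ j
        out = patch-out T target ρ

    bodyF⇔ : ∀ ρ N → let z = λ e → ρ ((R + N) + ((R + N) + codeIdx e)) in
      Sat ρ (bodyF S (N ∷ [])) ⇔ (Distinct z N ×
        (∀ (ctx : Vec ℕ (suc m)) → Chain firstPos N ctx →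
          Eqv N {Fin R} (ρ ∘ toℕ) (λ i → z (mapIdx (lookupV ctx) (Vec.lookup S i)))))
    bodyF⇔ ρ N = mk⇔
      (λ { (d , h) →
        (λ x y y<x x<N →
          to (loop⇔ firstPos 2 (distinctF S) N) d (y ∷ x ∷ N ∷ []) (y<x ∷ (x<N ∷ base)) ∘ sym) ,
        (λ ctx c → to (align ctx (chain-end c))
                      (to (loop⇔ firstPos m (matchF S) N) h ctx c)) })
      (λ { (d , h) →
        from (loop⇔ firstPos 2 (distinctF S) N)
          (λ { (y ∷ x ∷ _ ∷ []) (y<x ∷ (x<N ∷ base)) → d x y y<x x<N ∘ sym }) ,
        from (loop⇔ firstPos m (matchF S) N) (λ ctx c → from (align ctx (chain-end c)) (h ctx c)) })
      where
      align : ∀ ctx → end ctx ≡ N → Sat ρ (matchF S ctx) ⇔ Eqv N {Fin R} (ρ ∘ toℕ)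
        (λ i → ρ ((R + N) + ((R + N) + codeIdx (mapIdx (lookupV ctx) (Vec.lookup S i)))))
      align ctx refl = matchF⇔ ρ ctx

    closure-elim : ∀ ρ N → Sat ρ (close∃ R N (bodyF S (N ∷ []))) → ArrayAt S (ρ ∘ toℕ) N
    closure-elim ρ N h with close∃-elim R N (bodyF S (N ∷ [])) h
    ... | ρ′ , eq , h′ with to (bodyF⇔ ρ′ N) h′
    ...   | d , e = (λ e → ρ′ ((R + N) + ((R + N) + codeIdx e))) , d , λ ctx c →
      eqv-reindex N id (λ i → sym (eq (toℕ i) (toℕ<n i))) (λ _ → refl) (e ctx c)

    closure-intro : ExcludedMiddle 0ℓ → ∀ ρ N → ArrayAt S (ρ ∘ toℕ) N → Sat ρ (close∃ R N (bodyF S (N ∷ [])))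
    closure-intro em ρ N (z , d , e) =
      close∃-intro R N (bodyF S (N ∷ [])) (λ j j<R → off-array j (≤-trans j<R R≤T+T))
        (from (bodyF⇔ ρ′ N)
          ((λ x y y<x x<N eq → d x y y<x x<N (trans (sym (on-array _)) (trans eq (on-array _)))) ,
           (λ ctx c → eqv-reindex N id (λ i → off-array (toℕ i) (≤-trans (toℕ<n i) R≤T+T))
                                       (λ i → on-array _) (e ctx c))))
      where
      T = R + N
      R≤T+T : R ≤ T + T
      R≤T+T = ≤-trans (m≤m+n R N) (m≤m+n T T)
      decode = retraction em (0 , []) codeIdx codeIdx-injective
      ρ′ : Assignment
      ρ′ j with j <? T + T
      ... | yes _ = ρ j
      ... | no  _ = z (proj₁ decode (j ∸ (T + T)))
      off-array : ∀ j → j < T + T → ρ′ j ≡ ρ j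
      off-array j j< with j <? T + T
      ... | yes _ = refl
      ... | no j≮ = ⊥-elim (j≮ j<)
      on-array : ∀ e → ρ′ (T + (T + codeIdx e)) ≡ z e
      on-array e with T + (T + codeIdx e) <? T + T
      ... | yes lt = ⊥-elim (<⇒≱ lt (+-monoʳ-≤ T (m≤m+n T _)))
      ... | no  _  = cong z (trans (cong (proj₁ decode) (trans
          (cong (_∸ (T + T)) (sym (+-assoc T T (codeIdx e)))) (m+n∸m≡n (T + T) (codeIdx e))))
          (proj₂ decode e))

  env-lookup : ∀ {n} b (a : Vec A n) → env b a ∘ toℕ ≗ Vec.lookup (b ∷ a)
  env-lookup b a zero    = refl
  env-lookup b a (suc i) = envV-lookup a i
    where
    envV-lookup : ∀ {n} (a : Vec A n) i → envV b a (toℕ i) ≡ Vec.lookup a i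
    envV-lookup (x ∷ a) zero    = refl
    envV-lookup (x ∷ a) (suc i) = envV-lookup a i

  arrayAt-cong : ∀ {R m} {S : Vec (Idx (Fin (suc m))) R} {a a′ : Fin R → A} {N} → a ≗ a′ →
    ArrayAt S a N → ArrayAt S a′ N
  arrayAt-cong {N = N} eq (z , d , e) =
    z , d , λ ctx c → eqv-reindex N id (sym ∘ eq) (λ _ → refl) (e ctx c)

  -- A finite part of the type mentions finitely many `N`, so a witness for all `N` up to the
  -- largest of them satisfies it.
  realize-closures : RecursivelySaturated 𝔄 → ∀ {R} (F : ℕ → Formula) →
    CompF {1} (λ v → F (lookupV v #0)) → (a : Vec A R) →
    (∀ M → Σ A λ b → ∀ N → N ≤ M → Sat (env b a) (close∃ (suc R) N (F N))) →
    Σ A λ b → ∀ N → Sat (env b a) (close∃ (suc R) N (F N))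
  realize-closures sat {R} F F-comp a finite =
    let b , real = sat R a p (free , closures-recursive (suc R) F F-comp) finitelySatisfiable
    in b , λ N → real _ (N , refl)
    where
    p : Formula → Set
    p φ = Σ ℕ λ N → φ ≡ close∃ (suc R) N (F N)
    free : ∀ φ → p φ → FreeVarsBelow (suc R) φ
    free _ (N , refl) = free-close∃ L (suc R) N (F N)
    bound : ∀ {Φ} → All p Φ → Σ ℕ λ M → All (λ φ → Σ ℕ λ N → N ≤ M × φ ≡ close∃ (suc R) N (F N)) Φ
    bound [] = 0 , []
    bound ((N , eq) ∷ ps) =
      let M , qs = bound ps
      in N ⊔ M , (N , m≤m⊔n N M , eq) ∷
                 All.map (λ { (N′ , le , eq) → N′ , ≤-trans le (m≤n⊔m N M) , eq }) qs
    finitelySatisfiable : FinitelySatisfiable 𝔄 p a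
    finitelySatisfiable Φ ps =
      let M , qs = bound ps
          b , h  = finite M
      in b , All.map (λ { (N , le , refl) → h N le }) qs

  realize : ExcludedMiddle 0ℓ → RecursivelySaturated 𝔄 →
    ∀ {R m} (S : Vec (Idx (Fin (suc m))) (suc R)) (a : Vec A R) →
    (∀ M → Σ A λ b → ∀ N → N ≤ M → ArrayAt S (Vec.lookup (b ∷ a)) N) →
    Σ A λ b → ∀ N → ArrayAt S (Vec.lookup (b ∷ a)) N
  realize em sat S a finite =
    let b , real = realize-closures sat (λ N → bodyF S (N ∷ []))
          (compF-∘ (compF-bodyF S) (comp-lookup #0 ∷ᶜ []ᶜ)) a
          (λ M → let b , arrays = finite M in b , λ N le → closure-intro S em (env b a) N
            (arrayAt-cong {S = S} (λ i → sym (env-lookup b a i)) (arrays N le)))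
    in b , λ N → arrayAt-cong {S = S} (env-lookup b a) (closure-elim S (env b a) N (real N))

-- Points of ℚ and their samples in ℕ

mapIdx-cong : ∀ {P P′ : Set} {f g : P → P′} e → (∀ {p} → p ∈ proj₂ e → f p ≡ g p) →
  mapIdx f e ≡ mapIdx g e
mapIdx-cong (j , l) eq = cong (j ,_) (List.map-cong-local (All.tabulate eq))

mapIdx-∘ : ∀ {P P′ P″ : Set} (g : P′ → P″) (f : P → P′) e → mapIdx (g ∘ f) e ≡ mapIdx g (mapIdx f e)
mapIdx-∘ g f (j , l) = cong (j ,_) (List.map-∘ l)

points : ∀ {P : Set} {R} → Vec (Idx P) R → List P
points []            = []
points ((_ , l) ∷ E) = l ++ points E

∈-points : ∀ {P : Set} {R} (E : Vec (Idx P) R) i {p} → p ∈ proj₂ (Vec.lookup E i) → p ∈ points E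
∈-points ((_ , l) ∷ E) zero    p∈ = ∈-++⁺ˡ p∈
∈-points ((_ , l) ∷ E) (suc i) p∈ = ∈-++⁺ʳ l (∈-points E i p∈)

module _ {P A : Set} where

  values : ∀ {P′ : Set} {R} → (Idx P′ → A) → (P → P′) → Vec (Idx P) R → Vec A R
  values z f = Vec.map (λ e → z (mapIdx f e))

  values-cong : ∀ {P′ : Set} {R} (z : Idx P′ → A) {f g : P → P′} (E : Vec (Idx P) R) →
    (∀ {p} → p ∈ points E → f p ≡ g p) → values z f E ≡ values z g E
  values-cong z []            eq = refl
  values-cong z ((j , l) ∷ E) eq = cong₂ _∷_
    (cong z (mapIdx-cong (j , l) (eq ∘ ∈-++⁺ˡ))) (values-cong z E (eq ∘ ∈-++⁺ʳ l))

-- A sample of the points in `Q` among the first `N` numbers; its values outside `Q` are arbitrary.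
record Monotone (Q : List Q.ℚ) (N : ℕ) (f : Q.ℚ → ℕ) : Set where
  field
    increasing : ∀ {p q} → p ∈ Q → q ∈ Q → p Q.< q → f p < f q
    bounded    : ∀ {p} → p ∈ Q → f p < N
open Monotone

monotone-⊆ : ∀ {Q Q′ N N′ f} → (∀ {p} → p ∈ Q → p ∈ Q′) → N′ ≤ N → Monotone Q′ N′ f → Monotone Q N f
monotone-⊆ Q⊆Q′ N′≤N mono = record
  { increasing = λ p∈ q∈ → increasing mono (Q⊆Q′ p∈) (Q⊆Q′ q∈)
  ; bounded    = λ p∈ → ≤-trans (bounded mono (Q⊆Q′ p∈)) N′≤N }

rank : List Q.ℚ → Q.ℚ → ℕ
rank []      q = 0
rank (p ∷ Q) q with p Q.<? q
... | yes _ = suc (rank Q q)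
... | no  _ = rank Q q

rank≤length : ∀ Q q → rank Q q ≤ length Q
rank≤length []      q = z≤n
rank≤length (p ∷ Q) q with p Q.<? q
... | yes _ = s≤s (rank≤length Q q)
... | no  _ = m≤n⇒m≤1+n (rank≤length Q q)

rank-mono : ∀ Q {p q} → p Q.< q → rank Q p ≤ rank Q q
rank-mono [] p<q = z≤n
rank-mono (x ∷ Q) {p} {q} p<q with x Q.<? p | x Q.<? q
... | yes _   | yes _  = s≤s (rank-mono Q p<q)
... | yes x<p | no x≮q = ⊥-elim (x≮q (Q.<-trans x<p p<q))
... | no _    | yes _  = m≤n⇒m≤1+n (rank-mono Q p<q)
... | no _    | no _   = rank-mono Q p<q

rank-< : ∀ Q {p q} → p ∈ Q → p Q.< q → rank Q p < rank Q q
rank-< (x ∷ Q) {p} {q} p∈ p<q with x Q.<? p | x Q.<? q | p∈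
... | yes x<x | _      | here refl = ⊥-elim (Q.<-irrefl refl x<x)
... | no _    | yes _  | here refl = s≤s (rank-mono Q p<q)
... | no _    | no x≮q | here refl = ⊥-elim (x≮q p<q)
... | yes _   | yes _  | there p∈′ = s≤s (rank-< Q p∈′ p<q)
... | yes x<p | no x≮q | there _   = ⊥-elim (x≮q (Q.<-trans x<p p<q))
... | no _    | yes _  | there p∈′ = m≤n⇒m≤1+n (rank-< Q p∈′ p<q)
... | no _    | no _   | there p∈′ = rank-< Q p∈′ p<q

rank-monotone : ∀ Q → Monotone Q (suc (length Q)) (rank Q)
rank-monotone Q = record
  { increasing = λ p∈ _ → rank-< Q p∈
  ; bounded    = λ {p} _ → s≤s (rank≤length Q p) }

insert : Q.ℚ → List Q.ℚ → List Q.ℚ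
insert q []      = q ∷ []
insert q (p ∷ P) with Q.<-cmp q p
... | tri< _ _ _ = q ∷ p ∷ P
... | tri≈ _ _ _ = p ∷ P
... | tri> _ _ _ = p ∷ insert q P

insert-All : ∀ {C : Q.ℚ → Set} {q} P → C q → All C P → All C (insert q P)
insert-All [] c cs = c ∷ cs
insert-All {q = q} (p ∷ P) c (cp ∷ cs) with Q.<-cmp q p
... | tri< _ _ _ = c ∷ cp ∷ cs
... | tri≈ _ _ _ = cp ∷ cs
... | tri> _ _ _ = cp ∷ insert-All P c cs

insert-sorted : ∀ q {P} → AllPairs Q._<_ P → AllPairs Q._<_ (insert q P)
insert-sorted q [] = [] ∷ []
insert-sorted q {p ∷ P} (p<P ∷ ap) with Q.<-cmp q p
... | tri< q<p _ _ = (q<p ∷ All.map (Q.<-trans q<p) p<P) ∷ p<P ∷ ap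
... | tri≈ _ _ _   = p<P ∷ ap
... | tri> _ _ p<q = insert-All P p<q p<P ∷ insert-sorted q ap

∈-insert-new : ∀ q P → q ∈ insert q P
∈-insert-new q [] = here refl
∈-insert-new q (p ∷ P) with Q.<-cmp q p
... | tri< _ _ _   = here refl
... | tri≈ _ q≡p _ = here q≡p
... | tri> _ _ _   = there (∈-insert-new q P)

∈-insert-old : ∀ q P {p} → p ∈ P → p ∈ insert q P
∈-insert-old q (p ∷ P) p∈ with Q.<-cmp q p | p∈
... | tri< _ _ _ | _         = there p∈
... | tri≈ _ _ _ | _         = p∈
... | tri> _ _ _ | here eq   = here eq
... | tri> _ _ _ | there p∈′ = there (∈-insert-old q P p∈′)

sort : (Q : List Q.ℚ) → Σ (List Q.ℚ) λ P → AllPairs Q._<_ P ×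
  (∀ {p} → p ∈ Q → p ∈ P) × (∀ {p} → p ∈ P → p ∈ Q)
sort [] = [] , [] , id , id
sort (q ∷ Q) with sort Q
... | P , ap , Q⊆P , P⊆Q = insert q P , insert-sorted q ap ,
  (λ { (here refl) → ∈-insert-new q P ; (there p∈) → ∈-insert-old q P (Q⊆P p∈) }) ,
  All.lookup (insert-All P (here refl) (All.tabulate (there ∘ P⊆Q)))

-- A point outside `P` gets the last position, where a context holds its bound.
position : (P : List Q.ℚ) → Q.ℚ → Fin (suc (length P))
position []      q = zero
position (p ∷ P) q with q Q.≟ p
... | yes _ = zero
... | no  _ = suc (position P q)

sample : ∀ P → Vec ℕ (suc (length P)) → Q.ℚ → ℕ
sample P ctx q = lookupV ctx (position P q)

context : (P : List Q.ℚ) → (Q.ℚ → ℕ) → ℕ → Vec ℕ (suc (length P))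
context []      f N = N ∷ []
context (p ∷ P) f N = f p ∷ context P f N

sample-context : ∀ P f N {q} → q ∈ P → sample P (context P f N) q ≡ f q
sample-context (p ∷ P) f N {q} q∈ with q Q.≟ p | q∈
... | yes refl | _         = refl
... | no q≢p   | here eq   = ⊥-elim (q≢p eq)
... | no _     | there q∈′ = sample-context P f N q∈′

AllPairs-map : ∀ {f : Q.ℚ → ℕ} {P} → AllPairs Q._<_ P →
  (∀ {p q} → p ∈ P → q ∈ P → p Q.< q → f p < f q) → AllPairs _<_ (List.map f P)
AllPairs-map []         inc = []
AllPairs-map (p<P ∷ ap) inc =
  All.map⁺ (All.tabulate (λ q∈ → inc (here refl) (there q∈) (All.lookup p<P q∈))) ∷
  AllPairs-map ap (λ p∈ q∈ → inc (there p∈) (there q∈))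

AllPairs-⊆ : ∀ {X : Set} {_~_ : X → X → Set} {xs ys : List X} → xs ⊆ ys → AllPairs _~_ ys → AllPairs _~_ xs
AllPairs-⊆ []         []       = []
AllPairs-⊆ (y ∷ʳ s)   (_ ∷ ap) = AllPairs-⊆ s ap
AllPairs-⊆ (refl ∷ s) (p ∷ ap) = All-resp-⊆ s p ∷ AllPairs-⊆ s ap

module Subsequence {M N S} (S⊆ : S ⊆ upTo M) (N≤ : N ≤ length S) where

  -- Embeds the numbers below `N` increasingly into the homogeneous set, so that samples below `N`
  -- become samples of the longer array.
  nth : ℕ → ℕ
  nth = at 0 S

  map-nth-⊆ : ∀ {xs} → AllPairs _<_ xs → All (_< N) xs → List.map nth xs ⊆ S
  map-nth-⊆ {xs} ap xs<N = map-at-⊆ 0 S xs ap (All.map (λ _ → z≤n) xs<N) (All.map (λ x< → ≤-trans x< N≤) xs<N)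

  nth-increasing : ∀ {i j} → i < j → j < N → nth i < nth j
  nth-increasing i<j j<N
    with AllPairs-⊆ (⊆-trans (map-nth-⊆ ((i<j ∷ []) ∷ [] ∷ []) (<-trans i<j j<N ∷ j<N ∷ [])) S⊆)
           (AllPairs.applyUpTo⁺₁ id M (λ i<j _ → i<j))
  ... | (lt ∷ []) ∷ _ = lt

  nth-bounded : ∀ {i} → i < N → nth i < M
  nth-bounded i<N
    with All-resp-⊆ (⊆-trans (map-nth-⊆ ([] ∷ []) (i<N ∷ [])) S⊆) (All.applyUpTo⁺₁ id M id)
  ... | lt ∷ [] = lt

  nth-monotone : ∀ {Q f} → Monotone Q N f → Monotone Q M (nth ∘ f)
  nth-monotone mono = record
    { increasing = λ p∈ q∈ p<q → nth-increasing (increasing mono p∈ q∈ p<q) (bounded mono q∈)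
    ; bounded    = λ p∈ → nth-bounded (bounded mono p∈) }

-- Inverse to f ↦ List.map f P on the points of P; 0 at other points.
readOff : List Q.ℚ → List ℕ → Q.ℚ → ℕ
readOff (p ∷ P) (x ∷ xs) q with q Q.≟ p
... | yes _ = x
... | no  _ = readOff P xs q
readOff _ _ q = 0

readOff-map : ∀ P (f : Q.ℚ → ℕ) {q} → q ∈ P → readOff P (List.map f P) q ≡ f q
readOff-map (p ∷ P) f {q} q∈ with q Q.≟ p | q∈
... | yes refl | _         = refl
... | no q≢p   | here eq   = ⊥-elim (q≢p eq)
... | no _     | there q∈′ = readOff-map P f q∈′

module _ {L : Language} (𝔄 : Structure L) where
  open TypeSemantics 𝔄 using (Chain; base; _∷_; chain-end)
  open TypeFormulas L

  chain-head : ∀ {m x N} {ctx : Vec ℕ (suc m)} → Chain firstPos N (x ∷ ctx) → ∀ i → x < lookupV ctx i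
  chain-head {ctx = y ∷ []}    (x< ∷ c) zero    = x<
  chain-head {ctx = y ∷ _ ∷ _} (x< ∷ c) zero    = x<
  chain-head {ctx = y ∷ _ ∷ _} (x< ∷ c) (suc i) = <-trans x< (chain-head c i)

  -- With `context-chain` this matches the contexts of the formulas with the increasing samples of
  -- the sorted points.
  sample-monotone : ∀ {N} P {ctx} → AllPairs Q._<_ P → Chain firstPos N ctx → Monotone P N (sample P ctx)
  sample-monotone {N} P sorted chain = record
    { increasing = inc P sorted chain ; bounded = bnd P chain }
    where
    bnd : ∀ P {ctx} → Chain firstPos N ctx → ∀ {q} → q ∈ P → sample P ctx q < N
    bnd (p ∷ P) {x ∷ ctx} c@(_ ∷ c′) {q} q∈ with q Q.≟ p | q∈
    ... | yes _  | _         = subst (x <_) (chain-end c′) (chain-head c (lastPos (length P)))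
    ... | no q≢p | here eq   = ⊥-elim (q≢p eq)
    ... | no _   | there q∈′ = bnd P c′ q∈′
    inc : ∀ P {ctx} → AllPairs Q._<_ P → Chain firstPos N ctx → ∀ {p q} → p ∈ P → q ∈ P → p Q.< q →
      sample P ctx p < sample P ctx q
    inc (x ∷ P) {_ ∷ ctx} (x<P ∷ ap) c@(_ ∷ c′) {p} {q} p∈ q∈ p<q with p Q.≟ x | q Q.≟ x | p∈ | q∈
    ... | yes refl | yes refl | _         | _         = ⊥-elim (Q.<-irrefl refl p<q)
    ... | yes _    | no _     | _         | _         = chain-head c (position P q)
    ... | no p≢x   | _        | here eq   | _         = ⊥-elim (p≢x eq)
    ... | no _     | yes refl | there p∈′ | _         = ⊥-elim (Q.<-asym p<q (All.lookup x<P p∈′))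
    ... | no _     | no q≢x   | _         | here eq   = ⊥-elim (q≢x eq)
    ... | no _     | no _     | there p∈′ | there q∈′ = inc P ap c′ p∈′ q∈′ p<q

  context-chain : ∀ {N f} P → AllPairs Q._<_ P → Monotone P N f → Chain firstPos N (context P f N)
  context-chain []          _ _ = base
  context-chain (p ∷ [])    _ mono = bounded mono (here refl) ∷ base
  context-chain (p ∷ q ∷ P) ((p<q ∷ _) ∷ ap) mono =
    increasing mono (here refl) (there (here refl)) p<q ∷
    context-chain (q ∷ P) ap (monotone-⊆ there ≤-refl mono)

-- Finite approximations

module Conditions {L : Language} (𝔄 : Structure L) (em : ExcludedMiddle 0ℓ)
                  (x₀ : Structure.Carrier 𝔄) where
  open Structure 𝔄 renaming (Carrier to A)
  open TypeFormulas L
  open Game 𝔄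
  open TypeSemantics 𝔄 using (Chain; base; _∷_; chain-end)
  open ArrayTypes 𝔄

  -- Finite arrays stand in for an indiscernible array over ℚ extending a, so that the condition is
  -- a recursive type.
  ConditionAt : ∀ {R} → Vec (Idx Q.ℚ) R → Vec A R → ℕ → ℕ → Set
  ConditionAt E a n N = Σ (Idx ℕ → A) λ z → Distinct z N ×
    (∀ f → Monotone (points E) N f → Eqv n (Vec.lookup a) (Vec.lookup (values z f E)))

  Condition : ∀ {R} → Vec (Idx Q.ℚ) R → Vec A R → Set
  Condition E a = ∀ n N → ConditionAt E a n N

  condition-≤ : ∀ {R} {E : Vec (Idx Q.ℚ) R} {a n n′ N N′} → n ≤ n′ → N ≤ N′ →
    ConditionAt E a n′ N′ → ConditionAt E a n N
  condition-≤ n≤ N≤ (z , d , e) =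
    z , (λ x y y<x x<N → d x y y<x (≤-trans x<N N≤)) ,
    (λ f mono → eqv-≤ x₀ n≤ (e f (monotone-⊆ id N≤ mono)))

  codeList-≤ : ∀ {P : Set} {f : P → ℕ} {N} l → (∀ {p} → p ∈ l → f p ≤ N) →
    codeList (List.map f l) ≤ codeList (List.map (λ _ → N) l)
  codeList-≤ []      _  = z≤n
  codeList-≤ (p ∷ l) f≤ = s≤s (pair-mono (f≤ (here refl)) (codeList-≤ l (f≤ ∘ there)))

  -- Codes grow with their entries, so the constant sample `N` has the largest ones. The bound is
  -- the number of rounds spent on copying array elements.
  code-bound : ∀ {R} (E : Vec (Idx Q.ℚ) R) N → Σ ℕ λ B → ∀ i f →
    (∀ {p} → p ∈ points E → f p ≤ N) → codeIdx (mapIdx f (Vec.lookup E i)) < B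
  code-bound []            N = 0 , λ ()
  code-bound ((j , l) ∷ E) N with code-bound E N
  ... | B , bound = suc (codeIdx (mapIdx (λ _ → N) (j , l))) ⊔ B , λ
    { zero f f≤ → ≤-trans (s≤s (pair-mono (≤-refl {j}) (codeList-≤ l (f≤ ∘ ∈-++⁺ˡ)))) (m≤m⊔n _ B)
    ; (suc i) f f≤ → ≤-trans (bound i f (f≤ ∘ ∈-++⁺ʳ l)) (m≤n⊔m _ B) }

  reindex-∷ : ∀ n {R} b (a : Vec A R) c (v : Vec A R) →
    Eqv n (ext b (Vec.lookup a)) (ext c (Vec.lookup v)) → Eqv n (Vec.lookup (b ∷ a)) (Vec.lookup (c ∷ v))
  reindex-∷ n {R} b a c v = eqv-reindex n g (unfold b a) (unfold c v)
    where
    g : Fin (suc R) → Maybe (Fin R)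
    g zero    = nothing
    g (suc i) = just i
    unfold : ∀ b (a : Vec A R) → Vec.lookup (b ∷ a) ≗ ext b (Vec.lookup a) ∘ g
    unfold b a zero    = refl
    unfold b a (suc i) = refl

  -- An increasing tuple is coloured by the predicates of `finite-index`, evaluated at the values
  -- that it samples from the array.
  homogeneous-array : ∀ n {R} (E : Vec (Idx Q.ℚ) R) N → Σ ℕ λ M → ∀ (z : Idx ℕ → A) →
    Σ (List ℕ) λ S → Σ (S ⊆ upTo M) λ S⊆ → Σ (N ≤ length S) λ N≤ →
    ∀ f f′ → Monotone (points E) N f → Monotone (points E) N f′ →
    Eqv n (Vec.lookup (values z (at 0 S ∘ f) E)) (Vec.lookup (values z (at 0 S ∘ f′) E))
  homogeneous-array n {R} E N = M , λ z →
    let S , S⊆ , N≤ , hom = proj₂ (Ramsey.ramsey-family em m k N) (List.map (color z) Ds)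
                              (List.length-map (color z) Ds) (upTo M) (≤-reflexive (sym (List.length-upTo M)))
    in S , S⊆ , N≤ , λ f f′ mono mono′ → proj₂ index _ _
         (All.map (λ {D} h → mk⇔ (move z S⊆ N≤ D h f f′ mono mono′) (move z S⊆ N≤ D h f′ f mono′ mono))
                  (All.map⁻ hom))
    where
    sorted = sort (points E)
    P = proj₁ sorted
    m = length P
    index = finite-index em n R
    Ds = proj₁ index
    k = length Ds
    M = proj₁ (Ramsey.ramsey-family em {ℕ} m k N)
    color : (Idx ℕ → A) → (Vec A R → Set) → List ℕ → Set
    color z D xs = D (values z (readOff P xs) E)
    move : ∀ z {S} (S⊆ : S ⊆ upTo M) (N≤ : N ≤ length S) D →
      Ramsey.Homogeneous em m (color z D) S → ∀ f f′ → Monotone (points E) N f →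
      Monotone (points E) N f′ → D (values z (at 0 S ∘ f) E) → D (values z (at 0 S ∘ f′) E)
    move z {S} S⊆ N≤ D h f f′ mono mono′ Df =
      subst D (read f′) (h _ _ (inside f mono) (inside f′ mono′) (size f) (size f′)
        (subst D (sym (read f)) Df))
      where
      open Subsequence S⊆ N≤
      read : ∀ f → values z (readOff P (List.map (at 0 S) (List.map f P))) E ≡ values z (at 0 S ∘ f) E
      read f = values-cong z E λ {p} p∈ →
        trans (cong (λ xs → readOff P xs p) (sym (List.map-∘ P)))
              (readOff-map P (at 0 S ∘ f) (proj₁ (proj₂ (proj₂ sorted)) p∈))
      inside : ∀ f → Monotone (points E) N f → List.map (at 0 S) (List.map f P) ⊆ S
      inside f mono = map-nth-⊆
        (AllPairs-map (proj₁ (proj₂ sorted)) (increasing onP)) (All.map⁺ (All.tabulate (bounded onP)))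
        where
        onP : Monotone P N f
        onP = monotone-⊆ (proj₂ (proj₂ (proj₂ sorted))) ≤-refl mono
      size : ∀ f → length (List.map (at 0 S) (List.map f P)) ≡ m
      size f = trans (List.length-map (at 0 S) (List.map f P)) (List.length-map f P)

  module _ {R} {E : Vec (Idx Q.ℚ) R} {a : Vec A R} (cond : Condition E a) where

    -- Spoiler plays the value `c` of the new index at one sample `f₀` inside a homogeneous set, and
    -- `b` is the reply. Homogeneity then replaces `f₀` by any other sample `f`, and the array `z′`
    -- consists of replies to the elements of the old one.
    extend-finitely : ∀ e n N → Σ A λ b → ConditionAt (e ∷ E) (b ∷ a) n N
    extend-finitely e n N = b , z′ , distinct , λ f mono →
      eqv-trans n base-eqv (eqv-trans n
        (hom f₀ f mono₀ (monotone-⊆ id N≤N₁ mono)) (eqv-sym n (pulled f mono)))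
      where
      E⁺ = e ∷ E
      -- Room for the samples below `N` and also for `f₀`, whose values reach up to the number of
      -- points.
      N₁ = N + suc (length (points E⁺))
      N≤N₁ : N ≤ N₁
      N≤N₁ = m≤m+n N _
      homogeneous = homogeneous-array n E⁺ N₁
      M = proj₁ homogeneous
      -- The extra index only serves to bound the codes of the elements (0 , x ∷ []).
      bound = code-bound ((0 , Q.0ℚ ∷ []) ∷ E⁺) N
      B = proj₁ bound
      -- One round produces `b`, `B` rounds copy the array elements with codes below `B`, and `n`
      -- rounds remain.
      at-condition = cond (suc (B + n)) M
      z = proj₁ at-condition
      S  = proj₁ (proj₂ homogeneous z)
      S⊆ = proj₁ (proj₂ (proj₂ homogeneous z))
      N₁≤ = proj₁ (proj₂ (proj₂ (proj₂ homogeneous z)))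
      hom = proj₂ (proj₂ (proj₂ (proj₂ homogeneous z)))
      open Subsequence S⊆ N₁≤
      f₀ = rank (points E⁺)
      mono₀ : Monotone (points E⁺) N₁ f₀
      mono₀ = monotone-⊆ id (m≤n+m _ N) (rank-monotone (points E⁺))
      c = z (mapIdx (nth ∘ f₀) e)
      answer = proj₂ (proj₂ (proj₂ at-condition) (nth ∘ f₀)
                 (nth-monotone (monotone-⊆ (∈-++⁺ʳ (proj₂ e)) ≤-refl mono₀))) c
      b = proj₁ answer
      decode = retraction em (0 , []) codeIdx codeIdx-injective
      zᶜ : ℕ → A
      zᶜ k = z (mapIdx nth (proj₁ decode k))
      zᶜ-code : ∀ i → zᶜ (codeIdx i) ≡ z (mapIdx nth i)
      zᶜ-code i = cong (z ∘ mapIdx nth) (proj₂ decode i)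
      extended = eqv-extend B n zᶜ
        (reindex-∷ (B + n) b a c (values z (nth ∘ f₀) E) (proj₂ answer))
      y = proj₁ extended
      base-eqv : Eqv n (Vec.lookup (b ∷ a)) (Vec.lookup (values z (nth ∘ f₀) E⁺))
      base-eqv = eqv-reindex n inj₁ (λ _ → refl) (λ _ → refl) (proj₂ extended)
      z′ : Idx ℕ → A
      z′ = y ∘ codeIdx
      pulled : ∀ f → Monotone (points E⁺) N f →
        Eqv n (Vec.lookup (values z′ f E⁺)) (Vec.lookup (values z (nth ∘ f) E⁺))
      pulled f mono = eqv-reindex n
        (λ i → inj₂ (codeIdx (mapIdx f (Vec.lookup E⁺ i)) , below i))
        (λ i → Vec.lookup-map i _ E⁺)
        (λ i → trans (Vec.lookup-map i _ E⁺) (trans (cong z (mapIdx-∘ nth f (Vec.lookup E⁺ i)))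
                 (sym (zᶜ-code (mapIdx f (Vec.lookup E⁺ i))))))
        (proj₂ extended)
        where
        -- The extra index adds 0 to the points considered by `bound`, where `f` need not be
        -- bounded; the cap changes nothing on the points of `E⁺`.
        f′ : Q.ℚ → ℕ
        f′ p = f p ⊓ N
        below : ∀ i → codeIdx (mapIdx f (Vec.lookup E⁺ i)) < B
        below i = subst (λ e → codeIdx e < B)
          (mapIdx-cong (Vec.lookup E⁺ i) (λ p∈ → m≤n⇒m⊓n≡m (<⇒≤ (bounded mono (∈-points E⁺ i p∈)))))
          (proj₂ bound (suc i) f′ (λ {p} _ → m⊓n≤n (f p) N))
      distinct : Distinct z′ N
      distinct x x′ x′<x x<N eq =
        proj₁ (proj₂ at-condition) (nth x) (nth x′) (nth-increasing x′<x x<N₁) (nth-bounded x<N₁)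
          (trans (sym (zᶜ-code (0 , x ∷ []))) (trans
            (to (eqv-≤ x₀ z≤n (proj₂ extended)
                   (eqA (slot x (<⇒≤ x<N)) (slot x′ (<⇒≤ (<-trans x′<x x<N))))) eq)
            (zᶜ-code (0 , x′ ∷ []))))
        where
        x<N₁ : x < N₁
        x<N₁ = ≤-trans x<N N≤N₁
        slot : ∀ x → x ≤ N → Fin (suc R) ⊎ Σ ℕ (_< B)
        slot x x≤N = inj₂ (codeIdx (0 , x ∷ []) , proj₂ bound zero (λ _ → x) (λ _ → x≤N))

    -- Saturation handles the diagonal demands with `N` rounds and `N` points; the demand for `n`
    -- and `N` follows from the one for `n ⊔ N`.
    extend : RecursivelySaturated 𝔄 → ∀ e → Σ A λ b → Condition (e ∷ E) (b ∷ a)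
    extend sat e =
      let b , arrays = realize em sat shape a (λ M →
            let b , cond = extend-finitely e M M
            in b , λ N N≤M → toArray b N (condition-≤ {a = b ∷ a} N≤M N≤M cond))
      in b , λ n N → fromArray b n N (arrays (n ⊔ N))
      where
      E⁺ = e ∷ E
      sorted = sort (points E⁺)
      P = proj₁ sorted
      ascending = proj₁ (proj₂ sorted)
      E⁺⊆P : ∀ {p} → p ∈ points E⁺ → p ∈ P
      E⁺⊆P = proj₁ (proj₂ (proj₂ sorted))
      P⊆E⁺ : ∀ {p} → p ∈ P → p ∈ points E⁺
      P⊆E⁺ = proj₂ (proj₂ (proj₂ sorted))
      shape : Vec (Idx (Fin (suc (length P)))) (suc R)
      shape = Vec.map (mapIdx (position P)) E⁺
      sampled : ∀ (z : Idx ℕ → A) ctx i →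
        z (mapIdx (lookupV ctx) (Vec.lookup shape i)) ≡ Vec.lookup (values z (sample P ctx) E⁺) i
      sampled z ctx i = trans (cong (z ∘ mapIdx (lookupV ctx)) (Vec.lookup-map i (mapIdx (position P)) E⁺))
        (trans (cong z (sym (mapIdx-∘ (lookupV ctx) (position P) (Vec.lookup E⁺ i))))
               (sym (Vec.lookup-map i (λ e → z (mapIdx (sample P ctx) e)) E⁺)))
      toArray : ∀ b N → ConditionAt E⁺ (b ∷ a) N N → ArrayAt shape (Vec.lookup (b ∷ a)) N
      toArray b N (z , d , e) = z , d , λ ctx chain →
        eqv-reindex N id (λ _ → refl) (sampled z ctx)
          (e (sample P ctx) (monotone-⊆ E⁺⊆P ≤-refl (sample-monotone 𝔄 P ascending chain)))
      fromArray : ∀ b n N → ArrayAt shape (Vec.lookup (b ∷ a)) (n ⊔ N) → ConditionAt E⁺ (b ∷ a) n N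
      fromArray b n N (z , d , e) = condition-≤ {a = b ∷ a} (m≤m⊔n n N) (m≤n⊔m n N) (z , d , λ f mono →
        eqv-reindex (n ⊔ N) id (λ _ → refl)
          (λ i → trans (cong (λ v → Vec.lookup v i)
                          (values-cong z E⁺ (λ p∈ → sym (sample-context P f (n ⊔ N) (E⁺⊆P p∈)))))
                       (sym (sampled z (context P f (n ⊔ N)) i)))
          (e (context P f (n ⊔ N)) (context-chain 𝔄 P ascending (monotone-⊆ P⊆E⁺ ≤-refl mono))))

    -- The value of the fresh term at a sample of the points is the reply to b in the game with
    -- n + 1 rounds between a and that sample of the array.
    adjoin : ∀ b → Σ (Idx Q.ℚ) λ e → Condition (e ∷ E) (b ∷ a)
    adjoin b = e , step
      where
      -- `0 < j` keeps the new term apart from t_0, whose values have to stay distinct.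
      fresh : ∀ {R} (E : Vec (Idx Q.ℚ) R) → Σ ℕ λ j → 0 < j × (∀ i → proj₁ (Vec.lookup E i) < j)
      fresh []            = 1 , s≤s z≤n , λ ()
      fresh ((j , _) ∷ E) with fresh E
      ... | k , 0<k , <k = suc j ⊔ k , ≤-trans 0<k (m≤n⊔m (suc j) k) , λ
        { zero → m≤m⊔n (suc j) k ; (suc i) → ≤-trans (<k i) (m≤n⊔m (suc j) k) }
      j = proj₁ (fresh E)
      e = j , points E
      step : Condition (e ∷ E) (b ∷ a)
      step n N with cond (suc n) N
      ... | z , d , h = z′ , distinct , λ f mono → eqv f (monotone-⊆ ∈-++⁺ˡ ≤-refl mono)
        where
        -- An array element may depend only on the list `l`. Samples with the same list of images
        -- agree on all the points, so any of them may supply the reply; a list that is no sample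
        -- gets a default value.
        Known : List ℕ → Set
        Known l = Σ (Q.ℚ → ℕ) λ f → Monotone (points E) N f × List.map f (points E) ≡ l
        choose : ∀ l → Dec (Known l) → A
        choose l (yes (f , mono , _)) = proj₁ (proj₁ (h f mono) b)
        choose l (no _)               = b
        z′ : Idx ℕ → A
        z′ (k , l) with k ≟ j
        ... | yes _ = choose l em
        ... | no  _ = z (k , l)
        z′-new : ∀ l → z′ (j , l) ≡ choose l em
        z′-new l with j ≟ j
        ... | yes _ = refl
        ... | no j≢ = ⊥-elim (j≢ refl)
        z′-old : ∀ {k} l → k < j → z′ (k , l) ≡ z (k , l)
        z′-old {k} l k<j with k ≟ j
        ... | yes refl = ⊥-elim (<-irrefl refl k<j)
        ... | no _     = refl
        values-old : ∀ f {R} (E′ : Vec (Idx Q.ℚ) R) → (∀ i → proj₁ (Vec.lookup E′ i) < j) →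
          values z′ f E′ ≡ values z f E′
        values-old f []             _  = refl
        values-old f ((_ , l) ∷ E′) <j =
          cong₂ _∷_ (z′-old (List.map f l) (<j zero)) (values-old f E′ (<j ∘ suc))
        0<j = proj₁ (proj₂ (fresh E))
        distinct : Distinct z′ N
        distinct x y y<x x<N eq = d x y y<x x<N
          (trans (sym (z′-old (x ∷ []) 0<j)) (trans eq (z′-old (y ∷ []) 0<j)))
        chosen : ∀ f → Monotone (points E) N f → (k : Dec (Known (List.map f (points E)))) →
          Eqv n (ext b (Vec.lookup a)) (ext (choose (List.map f (points E)) k) (Vec.lookup (values z f E)))
        chosen f mono (no unknown) = ⊥-elim (unknown (f , mono , refl))
        chosen f mono (yes (f′ , mono′ , eq)) =
          subst (λ v → Eqv n (ext b (Vec.lookup a)) (ext (proj₁ (proj₁ (h f′ mono′) b)) (Vec.lookup v)))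
            (values-cong z E (pointwise (points E) eq)) (proj₂ (proj₁ (h f′ mono′) b))
          where
          pointwise : ∀ Q → List.map f′ Q ≡ List.map f Q → ∀ {p} → p ∈ Q → f′ p ≡ f p
          pointwise (_ ∷ Q) eq (here refl) = proj₁ (List.∷-injective eq)
          pointwise (_ ∷ Q) eq (there p∈)  = pointwise Q (proj₂ (List.∷-injective eq)) p∈
        eqv : ∀ f → Monotone (points E) N f →
          Eqv n (Vec.lookup (b ∷ a)) (Vec.lookup (values z′ f (e ∷ E)))
        eqv f mono = subst (λ v → Eqv n (Vec.lookup (b ∷ a)) (Vec.lookup v))
          (sym (cong₂ _∷_ (z′-new (List.map f (points E))) (values-old f E (proj₂ (proj₂ (fresh E))))))
          (reindex-∷ n b a _ (values z f E) (chosen f mono em))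

  -- There is nothing to match yet, and only the values of t_0 have to be distinct: this is where
  -- the structure must be infinite.
  initially : (num : ℕ → A) → (∀ {m n} → num m ≡ num n → m ≡ n) → Condition [] []
  initially num num-injective n N =
    (λ { (_ , []) → x₀ ; (_ , x ∷ _) → num x }) ,
    (λ x y y<x _ eq → <⇒≢ y<x (sym (num-injective eq))) ,
    (λ _ _ → eqv-refl n (Vec.lookup []))

-- The invariant presentation and the action

module _ (L : Language) where
  open Syntax L
  open TypeFormulas L

  codeℤ : ℤ → ℕ
  codeℤ (+ n)      = pair 0 n
  codeℤ (-[1+ n ]) = pair 1 n

  codeℤ-injective : ∀ {m n} → codeℤ m ≡ codeℤ n → m ≡ n
  codeℤ-injective {+ m} {+ n} eq = cong +_ (proj₂ (pair-injective {0} {m} {0} {n} eq))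
  codeℤ-injective {+ m} { -[1+ n ]} eq with pair-injective {0} {m} {1} {n} eq
  ... | () , _
  codeℤ-injective { -[1+ m ]} {+ n} eq with pair-injective {1} {m} {0} {n} eq
  ... | () , _
  codeℤ-injective { -[1+ m ]} { -[1+ n ]} eq = cong -[1+_] (proj₂ (pair-injective {1} {m} {1} {n} eq))

  codeℚ : Q.ℚ → ℕ
  codeℚ (Q.mkℚ n d _) = pair (codeℤ n) d

  codeℚ-injective : ∀ {p q} → codeℚ p ≡ codeℚ q → p ≡ q
  codeℚ-injective {Q.mkℚ m d _} {Q.mkℚ n e _} eq with pair-injective {codeℤ m} {d} {codeℤ n} {e} eq
  ... | eqℤ , refl with codeℤ-injective {m} {n} eqℤ
  ...   | refl = refl

StrictlyMonotone : (Q.ℚ → Q.ℚ) → Set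
StrictlyMonotone s = ∀ p q → p Q.< q → s p Q.< s q

module Construction (em : ExcludedMiddle 0ℓ) {L : Language} (𝔄 : Structure L)
                    (countable : CountablyInfinite 𝔄) (sat : RecursivelySaturated 𝔄) where
  open Language L
  open Structure 𝔄 renaming (Carrier to A)
  open TypeFormulas L
  open Game 𝔄

  enumerate : ℕ → A
  enumerate = Inverse.from countable

  number : A → ℕ
  number = Inverse.to countable

  enumerate-number : ∀ x → enumerate (number x) ≡ x
  enumerate-number = Inverse.strictlyInverseʳ countable

  enumerate-injective : ∀ {m n} → enumerate m ≡ enumerate n → m ≡ n
  enumerate-injective {m} {n} eq = trans (sym (Inverse.strictlyInverseˡ countable m))
    (trans (cong number eq) (Inverse.strictlyInverseˡ countable n))

  open Conditions 𝔄 em (enumerate 0)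

  numberIdx : Idx Q.ℚ → ℕ
  numberIdx e = codeIdx (mapIdx (codeℚ L) e)

  enumerateIdx : ℕ → Idx Q.ℚ
  enumerateIdx k = mapIdx (proj₁ (retraction em Q.0ℚ (codeℚ L) (codeℚ-injective L)))
                          (proj₁ (retraction em (0 , []) codeIdx codeIdx-injective) k)

  enumerate-numberIdx : ∀ e → enumerateIdx (numberIdx e) ≡ e
  enumerate-numberIdx (j , l) = trans
    (cong (mapIdx _) (proj₂ (retraction em (0 , []) codeIdx codeIdx-injective) _))
    (trans (sym (mapIdx-∘ _ (codeℚ L) (j , l)))
      (trans (mapIdx-cong (j , l) (λ {p} _ → proj₂ (retraction em Q.0ℚ (codeℚ L) (codeℚ-injective L)) p))
             (cong (j ,_) (List.map-id l))))

  record Stage : Set where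
    constructor stage
    field
      {size}    : ℕ
      indices   : Vec (Idx Q.ℚ) size
      elements  : Vec A size
      condition : Condition indices elements
  open Stage

  record _∋_↦_ (s : Stage) (e : Idx Q.ℚ) (x : A) : Set where
    constructor place
    field
      slot     : Fin (size s)
      index≡   : Vec.lookup (indices s) slot ≡ e
      element≡ : Vec.lookup (elements s) slot ≡ x
  open _∋_↦_

  _⊑_ : Stage → Stage → Set
  s ⊑ t = ∀ {e x} → s ∋ e ↦ x → t ∋ e ↦ x

  abstract
    extended : ∀ s e → Σ Stage λ t → s ⊑ t × Σ A λ x → t ∋ e ↦ x
    extended (stage E a cond) e =
      let b , cond′ = extend {E = E} {a} cond sat e
      in stage (e ∷ E) (b ∷ a) cond′ , (λ (place i p q) → place (suc i) p q) , b , place zero refl refl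

    adjoined : ∀ s x → Σ Stage λ t → s ⊑ t × Σ (Idx Q.ℚ) λ e → t ∋ e ↦ x
    adjoined (stage E a cond) x =
      let e , cond′ = adjoin {E = E} {a} cond x
      in stage (e ∷ E) (x ∷ a) cond′ , (λ (place i p q) → place (suc i) p q) , e , place zero refl refl

  -- Back-and-forth bookkeeping: each stage gives a value to the next index and then an index to the
  -- next element. An index may be placed several times.
  stages : ℕ → Stage
  half   : ℕ → Stage
  half k         = proj₁ (extended (stages k) (enumerateIdx k))
  stages zero    = stage [] [] (initially enumerate enumerate-injective)
  stages (suc k) = proj₁ (adjoined (half k) (enumerate k))

  half-⊑ : ∀ k → half k ⊑ stages (suc k)
  half-⊑ k = proj₁ (proj₂ (adjoined (half k) (enumerate k)))

  stages-≤ : ∀ {k l} → k ≤ l → stages k ⊑ stages l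
  stages-≤ k≤l = go (≤⇒≤′ k≤l)
    where
    go : ∀ {k l} → k ≤′ l → stages k ⊑ stages l
    go (≤′-reflexive refl) m = m
    go (≤′-step {l} k≤l)   m =
      half-⊑ l (proj₁ (proj₂ (extended (stages l) (enumerateIdx l))) (go k≤l m))

  val : Idx Q.ℚ → A
  val e = proj₁ (proj₂ (proj₂ (extended (stages (numberIdx e)) (enumerateIdx (numberIdx e)))))

  val-placed : ∀ e → stages (suc (numberIdx e)) ∋ e ↦ val e
  val-placed e = subst (λ e′ → stages (suc (numberIdx e)) ∋ e′ ↦ val e) (enumerate-numberIdx e)
    (half-⊑ (numberIdx e)
      (proj₂ (proj₂ (proj₂ (extended (stages (numberIdx e)) (enumerateIdx (numberIdx e)))))))

  rep : A → Idx Q.ℚ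
  rep x = proj₁ (proj₂ (proj₂ (adjoined (half (number x)) (enumerate (number x)))))

  rep-placed : ∀ x → stages (suc (number x)) ∋ rep x ↦ x
  rep-placed x = subst (λ y → stages (suc (number x)) ∋ rep x ↦ y) (enumerate-number x)
    (proj₂ (proj₂ (proj₂ (adjoined (half (number x)) (enumerate (number x))))))

  Matching : Stage → (Q.ℚ → Q.ℚ) → Set
  Matching st s = Σ (Idx Q.ℚ) λ e → Σ A λ x → Σ A λ y → (st ∋ e ↦ x) × (st ∋ mapIdx s e ↦ y)

  module _ (st : Stage) {s : Q.ℚ → Q.ℚ} where

    source target : Matching st s → A
    source (_ , x , _) = x
    target (_ , _ , y , _) = y

    -- Both sides are compared with one array, sampled along f ∘ s and along f.
    matching-eqv : StrictlyMonotone s → Eqv 0 source target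
    matching-eqv s-mono = eqv-trans 0 {a = source} {b = middle} {c = target}
      (eqv-reindex 0 (λ { (_ , _ , _ , m , _) → slot m })
        (λ { (_ , _ , _ , m , _) → sym (element≡ m) })
        (λ { (e , _ , _ , m , _) → sym (trans (valueAt (f ∘ s) (slot m)) (trans
              (cong (z ∘ mapIdx (f ∘ s)) (index≡ m)) (cong z (mapIdx-∘ f s e)))) })
        (h (f ∘ s) composed))
      (eqv-sym 0 {a = target} {b = middle}
        (eqv-reindex 0 (λ { (_ , _ , _ , _ , m) → slot m })
          (λ { (_ , _ , _ , _ , m) → sym (element≡ m) })
          (λ { (_ , _ , _ , _ , m) → sym (trans (valueAt f (slot m)) (cong (z ∘ mapIdx f) (index≡ m))) })
          (h f (monotone-⊆ ∈-++⁺ˡ ≤-refl (rank-monotone Q)))))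
      where
      E = indices st
      -- The rank in `Q` increases on the points and on their images alike, so that both `f` and
      -- `f ∘ s` are samples of the points of the stage.
      Q = points E ++ List.map s (points E)
      f = rank Q
      array = condition st 0 (suc (length Q))
      z = proj₁ array
      h = proj₂ (proj₂ array)
      composed : Monotone (points E) (suc (length Q)) (f ∘ s)
      composed = record
        { increasing = λ p∈ q∈ p<q → increasing (rank-monotone Q)
            (∈-++⁺ʳ (points E) (∈-map⁺ s p∈)) (∈-++⁺ʳ (points E) (∈-map⁺ s q∈)) (s-mono _ _ p<q)
        ; bounded = λ p∈ → bounded (rank-monotone Q) (∈-++⁺ʳ (points E) (∈-map⁺ s p∈)) }
      valueAt : ∀ g i → Vec.lookup (values z g E) i ≡ z (mapIdx g (Vec.lookup E i))
      valueAt g i = Vec.lookup-map i _ E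
      middle : Matching st s → A
      middle (e , _) = z (mapIdx f (mapIdx s e))

  -- Repeated placements are harmless: equality is an atom, and the comparison with `s = id` may
  -- assign the same target `x` to both placements.
  placed-unique : ∀ {st e x y} → st ∋ e ↦ x → st ∋ e ↦ y → x ≡ y
  placed-unique {st} {e} {x} {y} m m′ =
    from (matching-eqv st {id} (λ _ _ → id) (eqA (e , x , x , m , here′) (e , y , x , m′ , here′))) refl
    where
    here′ : st ∋ mapIdx id e ↦ x
    here′ = subst (st ∋_↦ x) (cong (proj₁ e ,_) (sym (List.map-id (proj₂ e)))) m

  val-rep : ∀ x → val (rep x) ≡ x
  val-rep x = placed-unique {stages (k ⊔ l)} (stages-≤ (m≤m⊔n k l) (val-placed (rep x)))
                                             (stages-≤ (m≤n⊔m k l) (rep-placed x))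
    where
    k = suc (numberIdx (rep x))
    l = suc (number x)

  -- The array of a stage keeps the values of t_0 distinct, and the game with no rounds already
  -- transfers an equality to it.
  val-distinct-< : ∀ {p q} → p Q.< q → val (0 , p ∷ []) ≢ val (0 , q ∷ [])
  val-distinct-< {p} {q} p<q eq = proj₁ (proj₂ array) (f q) (f p)
    (increasing mono (∈E mp) (∈E mq) p<q) (bounded mono (∈E mq))
    (trans (sym (valueAt mq)) (trans (to (proj₂ (proj₂ array) f mono (eqA (slot mq) (slot mp)))
      (trans (element≡ mq) (trans (sym eq) (sym (element≡ mp))))) (valueAt mp)))
    where
    k = suc (numberIdx (0 , p ∷ []))
    l = suc (numberIdx (0 , q ∷ []))
    st = stages (k ⊔ l)
    mp : st ∋ 0 , p ∷ [] ↦ val (0 , p ∷ [])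
    mp = stages-≤ (m≤m⊔n k l) (val-placed _)
    mq : st ∋ 0 , q ∷ [] ↦ val (0 , q ∷ [])
    mq = stages-≤ (m≤n⊔m k l) (val-placed _)
    E = indices st
    f = rank (points E)
    mono = rank-monotone (points E)
    array = condition st 0 (suc (length (points E)))
    ∈E : ∀ {p x} → st ∋ 0 , p ∷ [] ↦ x → p ∈ points E
    ∈E m = ∈-points E (slot m) (subst (λ e → _ ∈ proj₂ e) (sym (index≡ m)) (here refl))
    valueAt : ∀ {p x} (m : st ∋ 0 , p ∷ [] ↦ x) →
      Vec.lookup (values (proj₁ array) f E) (slot m) ≡ proj₁ array (0 , f p ∷ [])
    valueAt m = trans (Vec.lookup-map (slot m) _ E) (cong (proj₁ array ∘ mapIdx f) (index≡ m))

  val-point-injective : ∀ {p q} → val (0 , p ∷ []) ≡ val (0 , q ∷ []) → p ≡ q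
  val-point-injective {p} {q} eq with Q.<-cmp p q
  ... | tri< p<q _ _ = ⊥-elim (val-distinct-< p<q eq)
  ... | tri≈ _ p≡q _ = p≡q
  ... | tri> _ _ q<p = ⊥-elim (val-distinct-< q<p (sym eq))

  -- Invariance of the presentation under increasing maps of ℚ.

  module _ {s : Q.ℚ → Q.ℚ} (s-mono : StrictlyMonotone s) where

    ValMatching : ℕ → Set
    ValMatching k = Σ (Idx Q.ℚ) λ e → (stages k ∋ e ↦ val e) × (stages k ∋ mapIdx s e ↦ val (mapIdx s e))

    birth : Idx Q.ℚ → ℕ
    birth e = suc (numberIdx e) ⊔ suc (numberIdx (mapIdx s e))

    matched : ∀ {k} e → birth e ≤ k → ValMatching k
    matched e ≤k = e ,
      stages-≤ (≤-trans (m≤m⊔n (suc (numberIdx e)) (suc (numberIdx (mapIdx s e)))) ≤k) (val-placed e) ,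
      stages-≤ (≤-trans (m≤n⊔m (suc (numberIdx e)) (suc (numberIdx (mapIdx s e)))) ≤k)
        (val-placed (mapIdx s e))

    births : ∀ {n} → Vec (Idx Q.ℚ) n → ℕ
    births []       = 0
    births (e ∷ es) = birth e ⊔ births es

    matchedVec : ∀ {k n} (es : Vec (Idx Q.ℚ) n) → births es ≤ k →
      Σ (Vec (ValMatching k) n) λ ms → Vec.map proj₁ ms ≡ es
    matchedVec []       _  = [] , refl
    matchedVec (e ∷ es) ≤k with matchedVec es (≤-trans (m≤n⊔m (birth e) (births es)) ≤k)
    ... | ms , eq = matched e (≤-trans (m≤m⊔n (birth e) (births es)) ≤k) ∷ ms , cong (e ∷_) eq

    matchedAtom : (t : Atom L (Idx Q.ℚ)) → Σ ℕ λ k → Σ (Atom L (ValMatching k)) λ u → mapA proj₁ u ≡ t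
    matchedAtom (eqA e e′) = birth e ⊔ birth e′ ,
      eqA (matched e (m≤m⊔n (birth e) (birth e′))) (matched e′ (m≤n⊔m (birth e) (birth e′))) , refl
    matchedAtom (funA f es e) with matchedVec es (m≤m⊔n (births es) (birth e))
    ... | ms , eq = births es ⊔ birth e ,
      funA f ms (matched e (m≤n⊔m (births es) (birth e))) , cong (λ es → funA f es e) eq
    matchedAtom (relA r es) with matchedVec es (≤-refl {births es})
    ... | ms , eq = births es , relA r ms , cong (relA r) eq

    -- An atom mentions finitely many indices, so a single stage places all of them together with
    -- their images under `s`.
    val-invariant : ∀ t → Holds (mapA val t) ⇔ Holds (mapA (val ∘ mapIdx s) t)
    val-invariant t with matchedAtom t
    ... | k , u , refl = subst₂ (λ x y → Holds x ⇔ Holds y)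
      (mapA-∘ val proj₁ (λ _ → refl) u) (mapA-∘ (val ∘ mapIdx s) proj₁ (λ _ → refl) u)
      (eqv-reindex 0 {a = source (stages k)} {b = target (stages k)} inclusion (λ _ → refl) (λ _ → refl)
        (matching-eqv (stages k) s-mono) u)
      where
      inclusion : ValMatching k → Matching (stages k) s
      inclusion (e , m , m′) = e , val e , val (mapIdx s e) , m , m′

  act : (Q.ℚ → Q.ℚ) → A → A
  act s x = val (mapIdx s (rep x))

  act-cong : ∀ {s t} → s ≗ t → act s ≗ act t
  act-cong eq x = cong val (mapIdx-cong (rep x) (λ {p} _ → eq p))

  act-id : ∀ {s} → (∀ p → s p ≡ p) → ∀ x → act s x ≡ x
  act-id {s} eq x = trans (act-cong eq x)
    (trans (cong (λ l → val (proj₁ (rep x) , l)) (List.map-id (proj₂ (rep x)))) (val-rep x))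

  module _ {s : Q.ℚ → Q.ℚ} (s-mono : StrictlyMonotone s) where

    -- Independence of the representative: `rep (val e)` may differ from `e`, but that both have the
    -- same value is an atom and hence survives `s`.
    act-val : ∀ e → act s (val e) ≡ val (mapIdx s e)
    act-val e = to (val-invariant s-mono (eqA (rep (val e)) e)) (val-rep (val e))

    act-∘ : ∀ t x → act s (act t x) ≡ act (s ∘ t) x
    act-∘ t x = trans (act-val (mapIdx t (rep x))) (cong val (sym (mapIdx-∘ s t (rep x))))

    val-reps : ∀ {n} (xs : Vec A n) → Vec.map val (Vec.map rep xs) ≡ xs
    val-reps xs = trans (sym (Vec.map-∘ val rep xs)) (trans (Vec.map-cong val-rep xs) (Vec.map-id xs))

    act-reps : ∀ {n} (xs : Vec A n) → Vec.map (val ∘ mapIdx s) (Vec.map rep xs) ≡ Vec.map (act s) xs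
    act-reps xs = sym (Vec.map-∘ (val ∘ mapIdx s) rep xs)

    -- Every element has an index, in particular `funI f xs`, so the equation between a function and
    -- its value is an unnested atom to which invariance applies.
    act-fun : ∀ f xs → act s (funI f xs) ≡ funI f (Vec.map (act s) xs)
    act-fun f xs = sym (trans (cong (funI f) (sym (act-reps xs)))
      (to (val-invariant s-mono (funA f (Vec.map rep xs) (rep (funI f xs))))
        (trans (cong (funI f) (val-reps xs)) (sym (val-rep (funI f xs))))))

    act-rel : ∀ r xs → (relI r xs → relI r (Vec.map (act s) xs)) × (relI r (Vec.map (act s) xs) → relI r xs)
    act-rel r xs =
      (λ h → subst (relI r) (act-reps xs) (to invariant (subst (relI r) (sym (val-reps xs)) h))) ,
      (λ h → subst (relI r) (val-reps xs) (from invariant (subst (relI r) (sym (act-reps xs)) h)))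
      where
      invariant = val-invariant s-mono (relA r (Vec.map rep xs))

  module _ (σ : AutQ) where
    open Inverse (AutQ.bij σ) renaming (to to σ⁺; from to σ⁻)

    σ⁺-monotone : StrictlyMonotone σ⁺
    σ⁺-monotone p q = proj₁ (AutQ.ord σ p q)

    σ⁻-monotone : StrictlyMonotone σ⁻
    σ⁻-monotone p q p<q = proj₂ (AutQ.ord σ (σ⁻ p) (σ⁻ q))
      (subst₂ Q._<_ (sym (strictlyInverseˡ p)) (sym (strictlyInverseˡ q)) p<q)

    automorphism : Aut 𝔄
    automorphism = record
      { bij = mk↔ₛ′ (act σ⁺) (act σ⁻)
          (λ x → trans (act-∘ σ⁺-monotone σ⁻ x) (act-id strictlyInverseˡ x))
          (λ x → trans (act-∘ σ⁻-monotone σ⁺ x) (act-id strictlyInverseʳ x))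
      ; presF = act-fun σ⁺-monotone
      ; presR = act-rel σ⁺-monotone }

  embedding : GroupEmbedding 𝔄
  embedding = record
    { Φ    = automorphism
    ; cong = act-cong
    ; hom  = λ σ τ x → sym (act-∘ (σ⁺-monotone σ) (appQ τ) x)
    ; inj  = λ {σ} {τ} eq p → val-point-injective (trans (sym (act-val (σ⁺-monotone σ) (0 , p ∷ [])))
               (trans (eq (val (0 , p ∷ []))) (act-val (σ⁺-monotone τ) (0 , p ∷ [])))) }

theorem2 : ExcludedMiddle 0ℓ → (L : Language) (𝔄 : Structure L) →
    CountablyInfinite 𝔄 → RecursivelySaturated 𝔄 → GroupEmbedding 𝔄
theorem2 em L 𝔄 countable saturated = Construction.embedding em 𝔄 countable saturated
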